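{- Suppose that for all integers $n\geq1$, $m\geq2$ and all integers $\ell_a,\ell_b$ with $m^n\geq\ell_a\geq\ell_b>0$ the following holds: if $\ell_a+\ell_b\leq m^n$ then $|\Theta(Lex^{ -1}(n,m;\ell_a+\ell_b))|+\sigma_{n,m}(\ell_a,\ell_b)\leq|\Theta(Lex^{ -1}(n,m;\ell_a))|+|\Theta(Lex^{ -1}(n,m;\ell_b))|$, and if $\ell_a+\ell_b\geq m^n$ then $|\Theta(Lex^{ -1}(n,m;\ell_a+\ell_b-m^n))|+\sigma_{n,m}(\ell_a,\ell_b)\leq|\Theta(Lex^{ -1}(n,m;\ell_a))|+|\Theta(Lex^{ -1}(n,m;\ell_b))|$. Then for all integers $n\geq1$, $m\geq2$, $s,t\geq0$ with $s+t\leq m$, and all $0\leq\ell\leq m^n$, \[ \min\{|\Theta_{s,t}(S)|: S\subseteq\{0,\dots,m-1\}^n,\ |S|=\ell\}=|\Theta_{s,t}(Lex^{ -1}(n,m;\ell))|. \]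
   Context: $S(n,m)$ ($n\geq1$, $m\geq2$) is the graph on $\{0,\dots,m-1\}^n$ in which distinct $u,v$ are adjacent iff there is $h\in\{1,\dots,n\}$ with $u_i=v_i$ for $i<h$, $u_h\neq v_h$, and $u_j=v_h$, $v_j=u_h$ for all $j>h$. $\Theta(S)$ is the set of edges of $S(n,m)$ with exactly one endpoint in $S$. $Lex(v)=1+\sum_{i=1}^n v_im^{n-i}$ and $Lex^{ -1}(n,m;\ell)=\{v:Lex(v)\leq\ell\}$. Corner vertices are $i^n=(i,\dots,i)$; $q_{n,m}(\ell)$ is the number of corner vertices $v$ with $Lex(v)\leq\ell$. For $0\leq\ell_b\leq\ell_a\leq m^n$, $\sigma_{n,m}(\ell_a,\ell_b)=q_{n,m}(\ell_b)+q_{n,m}(\ell_a+\ell_b)-q_{n,m}(\ell_a)$ if $\ell_a+\ell_b<m^n$, and $=q_{n,m}(\ell_b)-q_{n,m}(\ell_a+\ell_b-m^n)+m-q_{n,m}(\ell_a)$ if $\ell_a+\ell_b\geq m^n$. Decorated graph: given $s+t\leq m$, let $I=\{0,\dots,s-1\}$, $J=\{s,\dots,s+t-1\}$, $K=\{s+t,\dots,m-1\}$; $S_{s,t}(n,m)$ is $S(n,m)$ with new exterior vertices $v_i$ ($i\in I\cup K$) and exterior edges $\{v_i,i^n\}$ ($i\in I\cup K$). For $S\subseteq\{0,\dots,m-1\}^n$, $\Theta_{s,t}(S)$ is the set of edges of $S_{s,t}(n,m)$ with exactly one endpoint in $S\cup\{v_i:i\in I\}$. -}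

module Defs where

open import Data.Nat using (ℕ; zero; suc; _+_; _*_; _∸_; _^_; _≤_; _<_; _≤ᵇ_; _<ᵇ_)
import Data.Nat.Properties as ℕP
open import Data.Bool using (Bool; true; false; _∧_; _∨_; _xor_; not; T)
open import Data.Fin using (Fin; toℕ)
import Data.Fin.Properties as FinP
open import Data.Vec using (Vec; []; _∷_; lookup; replicate)
open import Data.List using (List; []; _∷_; map; concatMap; length; filter; allFin; cartesianProduct)
open import Data.Product using (Σ; _×_; _,_; proj₁; proj₂)
open import Relation.Nullary using (Dec; yes; no; ¬_)
open import Relation.Nullary.Decidable using (_×-dec_; _→-dec_; ¬?)
open import Relation.Binary.PropositionalEquality using (_≡_; _≢_)
open import Data.Bool.Properties using (T?)

-- Vertices of S(n,m): words of length n over {0,…,m-1}; coordinate i (1-based in the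
-- paper) is  lookup v i  with i : Fin n (0-based).
Vertex : ℕ → ℕ → Set
Vertex n m = Vec (Fin m) n

allVertices : (n m : ℕ) → List (Vertex n m)
allVertices zero    m = [] ∷ []
allVertices (suc n) m = concatMap (λ x → map (x ∷_) (allVertices n m)) (allFin m)

count : {A : Set} {P : A → Set} → ((x : A) → Dec (P x)) → List A → ℕ
count P? xs = length (filter P? xs)

AdjAt : {n m : ℕ} → Vertex n m → Vertex n m → Fin n → Set
AdjAt u v h =
  ((i : Fin _) → toℕ i < toℕ h → lookup u i ≡ lookup v i) ×
  (lookup u h ≢ lookup v h) ×
  ((j : Fin _) → toℕ h < toℕ j → (lookup u j ≡ lookup v h) × (lookup v j ≡ lookup u h))

Adj : {n m : ℕ} → Vertex n m → Vertex n m → Set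
Adj {n} u v = Σ (Fin n) (AdjAt u v)

adjAt? : {n m : ℕ} (u v : Vertex n m) (h : Fin n) → Dec (AdjAt u v h)
adjAt? u v h =
  FinP.all? (λ i → (toℕ i ℕP.<? toℕ h) →-dec (lookup u i FinP.≟ lookup v i))
  ×-dec ¬? (lookup u h FinP.≟ lookup v h)
  ×-dec FinP.all? (λ j → (toℕ h ℕP.<? toℕ j) →-dec
           ((lookup u j FinP.≟ lookup v h) ×-dec (lookup v j FinP.≟ lookup u h)))

adj? : {n m : ℕ} (u v : Vertex n m) → Dec (Adj u v)
adj? u v = FinP.any? (adjAt? u v)

VSet : ℕ → ℕ → Set
VSet n m = Vertex n m → Bool

card : {n m : ℕ} → VSet n m → ℕ
card {n} {m} S = count (λ v → T? (S v)) (allVertices n m)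

-- |Θ(S)|: edges {u,v} of S(n,m) with exactly one endpoint in S.  Each such edge is
-- counted once, as the ordered pair (u,v) with u ∈ S, v ∉ S.
Θ : {n m : ℕ} → VSet n m → ℕ
Θ {n} {m} S =
  count (λ p → T? (S (proj₁ p) ∧ not (S (proj₂ p))) ×-dec adj? (proj₁ p) (proj₂ p))
        (cartesianProduct (allVertices n m) (allVertices n m))

lexSum : {n m : ℕ} → Vertex n m → ℕ
lexSum {suc n} {m} (x ∷ xs) = toℕ x * m ^ n + lexSum xs
lexSum {zero}  []           = 0

Lex : {n m : ℕ} → Vertex n m → ℕ
Lex v = 1 + lexSum v

Lex⁻¹ : (n m ℓ : ℕ) → VSet n m
Lex⁻¹ n m ℓ v = Lex v ≤ᵇ ℓ

corner : (n : ℕ) {m : ℕ} → Fin m → Vertex n m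
corner n i = replicate n i

q : (n m ℓ : ℕ) → ℕ
q n m ℓ = count (λ i → T? (Lex (corner n i) ≤ᵇ ℓ)) (allFin m)

-- σ_{n,m}(ℓa,ℓb).  In the relevant range (ℓb ≤ ℓa ≤ m^n) every truncated subtraction
-- below is a genuine subtraction of a smaller number from a larger one, so this is the
-- paper's integer expression.
σ : (n m ℓa ℓb : ℕ) → ℕ
σ n m ℓa ℓb with suc (ℓa + ℓb) ≤ᵇ m ^ n
... | true  = q n m ℓb + (q n m (ℓa + ℓb) ∸ q n m ℓa)
... | false = (q n m ℓb ∸ q n m (ℓa + ℓb ∸ m ^ n)) + (m ∸ q n m ℓa)

-- |Θ_{s,t}(S)| in the decorated graph S_{s,t}(n,m).  Its edges are the edges of
-- S(n,m) and the exterior edges {v_i, i^n} for i ∈ I ∪ K, where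
-- I = {0,…,s-1}, J = {s,…,s+t-1}, K = {s+t,…,m-1}.  An edge is counted iff exactly
-- one endpoint lies in S ∪ {v_i : i ∈ I}.  For an edge of S(n,m) this means exactly
-- one endpoint in S (counted by Θ); for an exterior edge {v_i,i^n} it means
-- (v_i ∈ {v_j : j ∈ I}, i.e. i ∈ I)  xor  (i^n ∈ S).
inI : (s : ℕ) {m : ℕ} → Fin m → Bool
inI s i = toℕ i <ᵇ s

inK : (s t : ℕ) {m : ℕ} → Fin m → Bool
inK s t i = (s + t) ≤ᵇ toℕ i

exteriorΘ : {n m : ℕ} (s t : ℕ) → VSet n m → ℕ
exteriorΘ {n} {m} s t S =
  count (λ i → T? ((inI s i ∨ inK s t i) ∧ (inI s i xor S (corner n i)))) (allFin m)

Θst : {n m : ℕ} (s t : ℕ) → VSet n m → ℕ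
Θst s t S = Θ S + exteriorΘ s t S

{-# OPTIONS --safe #-}
module Submission where

-- Write L(ℓ) = |Θ(Lex⁻¹(ℓ))| and let κ(S) be the number of corners in S.  The decorations are
-- absorbed into the single inequality  L(|S|) + |κ(S) − q(|S|)| ≤ |Θ(S)|,  proved by induction
-- on n; the exterior term is then controlled because it is 1-Lipschitz in the number of corners.
--
-- S(n+1,m) consists of m copies of S(n,m), with one edge between x yⁿ and y xⁿ for x ≠ y.  For S
-- with parts S_x of sizes ℓ_x, put M_xy = [yⁿ ∈ S_x]; then Θ(S) = Σ Θ(S_x) + cross(M).
-- The hypothesis says that two partially filled copies can be merged so that one of them becomes full or
-- empty, with Σ L dropping by at least the total change of the q's.  So one may assume that
-- all copies but one are full or empty, and, since cross is 1-Lipschitz in the entries of M,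
-- that the rows of M belonging to full and empty copies are constant.  For such matrices
-- cross is explicit, and comparing with the lexicographic segment is a triangle inequality.

open import Defs
open import Data.Bool using (Bool; true; false; _∧_; _∨_; _xor_; not; if_then_else_)
open import Data.Bool.Properties using (T?; ∧-zeroʳ; xor-comm; xor-same)
open import Data.Fin using (Fin; zero; suc; toℕ; fromℕ<)
open import Data.Fin.Properties using (_≟_; toℕ<n; toℕ-fromℕ<; toℕ-injective)
open import Data.List as List using (List; []; _∷_; allFin; cartesianProduct)
open import Data.Nat using (ℕ; zero; suc; _+_; _*_; _∸_; _^_; _≤_; _<_; _≤ᵇ_; _<ᵇ_; ∣_-_∣; z≤n; s≤s)
open import Data.Nat.ListAction using () renaming (sum to listSum)
open import Data.Nat.Properties renaming (_≟_ to _ℕ≟_)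
open import Data.Nat.Tactic.RingSolver using (solve-∀)
open import Data.Product using (∃; ∃₂; _×_; _,_; proj₁; proj₂)
open import Data.Sum using (_⊎_; inj₁; inj₂; swap)
open import Data.Vec using ([]; _∷_; lookup)
import Data.Vec.Functional as Functional
open import Data.Vec.Properties using (≡-dec; lookup-replicate)
open import Function using (_∘_; id; mk⇔; _⇔_)
open import Relation.Binary.PropositionalEquality using (_≡_; _≢_; refl; sym; trans; cong; cong₂; subst; module ≡-Reasoning)
open import Relation.Nullary using (Dec; yes; no; does; ¬_; contradiction)
open import Relation.Nullary.Decidable using (dec-true; dec-false; does-⇔; _×-dec_; _⊎-dec_)

open import Algebra.Properties.Semiring.Sum +-*-semiring
  using (sum; sum-syntax; sum-cong-≗; sum-replicate-zero; ∑-distrib-+; ∑-comm; *-distribˡ-sum; *-distribʳ-sum)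

-- Finite sums

⟦_⟧ : Bool → ℕ
⟦ true  ⟧ = 1
⟦ false ⟧ = 0

⟦⟧≤1 : ∀ b → ⟦ b ⟧ ≤ 1
⟦⟧≤1 true  = ≤-refl
⟦⟧≤1 false = z≤n

sum-mono-≤ : ∀ {m} {f g : Fin m → ℕ} → (∀ i → f i ≤ g i) → sum f ≤ sum g
sum-mono-≤ {zero}  f≤g = z≤n
sum-mono-≤ {suc m} f≤g = +-mono-≤ (f≤g zero) (sum-mono-≤ (f≤g ∘ suc))

sum-zero : ∀ {m} {f : Fin m → ℕ} → (∀ i → f i ≡ 0) → sum f ≡ 0
sum-zero {m} f≡0 = trans (sum-cong-≗ f≡0) (sum-replicate-zero m)

sum-const : ∀ m c → ∑[ _ < m ] c ≡ m * c
sum-const zero    c = refl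
sum-const (suc m) c = cong (c +_) (sum-const m c)

-- A weighted Kronecker delta. It writes the contribution of one row, column or diagonal as a full
-- sum, so that identities between double sums can be checked entry by entry.
at : ∀ {m} → Fin m → Fin m → ℕ → ℕ
at a x c = if does (x ≟ a) then c else 0

sum-at : ∀ {m} (a : Fin m) (g : Fin m → ℕ) → ∑[ x < m ] at a x (g x) ≡ g a
sum-at {suc m} zero    g = trans (cong (g zero +_) (sum-replicate-zero m)) (+-identityʳ (g zero))
sum-at {suc m} (suc a) g = sum-at a (g ∘ suc)

∣sum-sum∣≤ : ∀ {m} (f g : Fin m → ℕ) → ∣ sum f - sum g ∣ ≤ ∑[ x < m ] ∣ f x - g x ∣
∣sum-sum∣≤ {zero}  f g = z≤n
∣sum-sum∣≤ {suc m} f g = ≤-trans (∣+-+∣≤ (f zero) (g zero) _ _) (+-monoʳ-≤ _ (∣sum-sum∣≤ (f ∘ suc) (g ∘ suc)))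
  where
  ∣+-+∣≤ : ∀ a b c d → ∣ a + c - b + d ∣ ≤ ∣ a - b ∣ + ∣ c - d ∣
  ∣+-+∣≤ a b c d = begin
    ∣ a + c - b + d ∣                       ≤⟨ ∣-∣-triangle (a + c) (b + c) (b + d) ⟩
    ∣ a + c - b + c ∣ + ∣ b + c - b + d ∣   ≡⟨ cong₂ _+_ (trans (cong₂ ∣_-_∣ (+-comm a c) (+-comm b c)) (∣m+n-m+o∣≡∣n-o∣ c a b)) (∣m+n-m+o∣≡∣n-o∣ b c d) ⟩
    ∣ a - b ∣ + ∣ c - d ∣                   ∎
    where open ≤-Reasoning

-- Counts as sums of indicators over lists

weight : {A : Set} → (A → ℕ) → List A → ℕ
weight w xs = listSum (List.map w xs)

weight-cong : {A : Set} {w w′ : A → ℕ} → (∀ x → w x ≡ w′ x) → ∀ xs → weight w xs ≡ weight w′ xs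
weight-cong w≗w′ []       = refl
weight-cong w≗w′ (x ∷ xs) = cong₂ _+_ (w≗w′ x) (weight-cong w≗w′ xs)

weight-zero : {A : Set} {w : A → ℕ} → (∀ x → w x ≡ 0) → ∀ xs → weight w xs ≡ 0
weight-zero w≡0 []       = refl
weight-zero w≡0 (x ∷ xs) = cong₂ _+_ (w≡0 x) (weight-zero w≡0 xs)

weight-++ : {A : Set} (w : A → ℕ) (xs ys : List A) → weight w (xs List.++ ys) ≡ weight w xs + weight w ys
weight-++ w []       ys = refl
weight-++ w (x ∷ xs) ys = trans (cong (w x +_) (weight-++ w xs ys)) (sym (+-assoc (w x) _ _))

weight-map : {A B : Set} (w : B → ℕ) (f : A → B) (xs : List A) → weight w (List.map f xs) ≡ weight (w ∘ f) xs
weight-map w f []       = refl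
weight-map w f (x ∷ xs) = cong (w (f x) +_) (weight-map w f xs)

weight-cartesianProduct : {A B : Set} (w : A × B → ℕ) (xs : List A) (ys : List B) →
  weight w (cartesianProduct xs ys) ≡ weight (λ x → weight (λ y → w (x , y)) ys) xs
weight-cartesianProduct w []       ys = refl
weight-cartesianProduct w (x ∷ xs) ys = trans (weight-++ w (List.map (x ,_) ys) _)
  (cong₂ _+_ (weight-map w (x ,_) ys) (weight-cartesianProduct w xs ys))

weight-tabulate : {A : Set} (w : A → ℕ) {m : ℕ} (f : Fin m → A) → weight w (List.tabulate f) ≡ sum (w ∘ f)
weight-tabulate w {zero}  f = refl
weight-tabulate w {suc m} f = cong (w (f zero) +_) (weight-tabulate w (f ∘ suc))

weight-concatMap : {A B : Set} (w : B → ℕ) (g : A → List B) {m : ℕ} (f : Fin m → A) →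
  weight w (List.concatMap g (List.tabulate f)) ≡ ∑[ i < m ] weight w (g (f i))
weight-concatMap w g {zero}  f = refl
weight-concatMap w g {suc m} f = trans (weight-++ w (g (f zero)) _)
  (cong (weight w (g (f zero)) +_) (weight-concatMap w g (f ∘ suc)))

count≡weight : {A : Set} {P : A → Set} (P? : ∀ x → Dec (P x)) (xs : List A) →
  count P? xs ≡ weight (λ x → ⟦ does (P? x) ⟧) xs
count≡weight P? []       = refl
count≡weight P? (x ∷ xs) with does (P? x)
... | true  = cong suc (count≡weight P? xs)
... | false = count≡weight P? xs

count-allFin : ∀ {m} {P : Fin m → Set} (P? : ∀ i → Dec (P i)) →
  count P? (allFin m) ≡ ∑[ i < m ] ⟦ does (P? i) ⟧
count-allFin P? = trans (count≡weight P? (allFin _)) (weight-tabulate (λ i → ⟦ does (P? i) ⟧) id)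

-- Sums over vertices and the decomposition of S(n+1,m) into m copies of S(n,m)

∑v : ∀ {n m} → (Vertex n m → ℕ) → ℕ
∑v {n} {m} w = weight w (allVertices n m)

∑v-suc : ∀ {n m} (w : Vertex (suc n) m → ℕ) → ∑v w ≡ ∑[ x < m ] ∑v (λ v → w (x ∷ v))
∑v-suc {n} {m} w = trans (weight-concatMap w (λ x → List.map (x ∷_) (allVertices n m)) id)
  (sum-cong-≗ λ x → weight-map w (x ∷_) (allVertices n m))

_≟v_ : ∀ {n m} (u v : Vertex n m) → Dec (u ≡ v)
_≟v_ = ≡-dec _≟_

-- In other words, each vertex is listed exactly once in `allVertices`. This isolates the single
-- edge between two copies.
∑v-at : ∀ {n m} (c : Vertex n m) (w : Vertex n m → ℕ) →
  ∑v (λ u → if does (u ≟v c) then w u else 0) ≡ w c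
∑v-at []      w = +-identityʳ (w [])
∑v-at {suc n} {m} (y ∷ c) w = begin
  ∑v (λ u → if does (u ≟v (y ∷ c)) then w u else 0)
    ≡⟨ ∑v-suc (λ u → if does (u ≟v (y ∷ c)) then w u else 0) ⟩
  ∑[ x < m ] ∑v (λ u → if does (x ≟ y) ∧ does (u ≟v c) then w (x ∷ u) else 0)
    ≡⟨ sum-cong-≗ row ⟩
  ∑[ x < m ] at y x (w (x ∷ c))
    ≡⟨ sum-at y (λ x → w (x ∷ c)) ⟩
  w (y ∷ c) ∎
  where
  open ≡-Reasoning
  row : ∀ x → ∑v (λ u → if does (x ≟ y) ∧ does (u ≟v c) then w (x ∷ u) else 0) ≡ at y x (w (x ∷ c))
  row x with does (x ≟ y)
  ... | true  = ∑v-at c (λ u → w (x ∷ u))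
  ... | false = weight-zero (λ _ → refl) (allVertices n m)

card≡∑v : ∀ {n m} (S : VSet n m) → card S ≡ ∑v (λ v → ⟦ S v ⟧)
card≡∑v {n} {m} S = count≡weight (λ v → T? (S v)) (allVertices n m)

copy : ∀ {n m} → VSet (suc n) m → Fin m → VSet n m
copy S x v = S (x ∷ v)

card-suc : ∀ {n m} (S : VSet (suc n) m) → card S ≡ ∑[ x < m ] card (copy S x)
card-suc {n} {m} S = trans (card≡∑v S) (trans (∑v-suc (λ v → ⟦ S v ⟧)) (sum-cong-≗ λ x → sym (card≡∑v (copy S x))))

card-cong : ∀ {n m} {S S′ : VSet n m} → (∀ v → S v ≡ S′ v) → card S ≡ card S′
card-cong {n} {m} {S} {S′} S≗S′ = trans (card≡∑v S)
  (trans (weight-cong (λ v → cong ⟦_⟧ (S≗S′ v)) (allVertices n m)) (sym (card≡∑v S′)))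

crossing : ∀ {n m} → VSet n m → VSet n m → Vertex n m → Vertex n m → ℕ
crossing S S′ u v = ⟦ (S u ∧ not (S′ v)) ∧ does (adj? u v) ⟧

Θ≡∑v : ∀ {n m} (S : VSet n m) → Θ S ≡ ∑v (λ u → ∑v (λ v → crossing S S u v))
Θ≡∑v {n} {m} S = trans (count≡weight edge? (cartesianProduct V V)) (weight-cartesianProduct _ V V)
  where
  V = allVertices n m
  edge? = λ (p : Vertex n m × Vertex n m) → T? (S (proj₁ p) ∧ not (S (proj₂ p))) ×-dec adj? (proj₁ p) (proj₂ p)

Θ-cong : ∀ {n m} {S S′ : VSet n m} → (∀ v → S v ≡ S′ v) → Θ S ≡ Θ S′
Θ-cong {n} {m} {S} {S′} S≗S′ = trans (Θ≡∑v S) (trans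
  (weight-cong (λ u → weight-cong (λ v →
    cong₂ (λ b b′ → ⟦ (b ∧ not b′) ∧ does (adj? u v) ⟧) (S≗S′ u) (S≗S′ v)) V) V)
  (sym (Θ≡∑v S′)))
  where V = allVertices n m

Θ-const : ∀ {n m} (b : Bool) → Θ {n} {m} (λ _ → b) ≡ 0
Θ-const {n} {m} b = trans (Θ≡∑v {n} {m} (λ _ → b))
  (weight-zero (λ u → weight-zero (λ v → lemma b (does (adj? u v))) V) V)
  where
  V = allVertices n m
  lemma : ∀ b c → ⟦ (b ∧ not b) ∧ c ⟧ ≡ 0
  lemma true  c = refl
  lemma false c = refl

-- Equal first letters rule out the first position as the place `h` of difference, so `h` only
-- shifts by one.
adj-same : ∀ {n m} (x : Fin m) (u v : Vertex n m) → Adj (x ∷ u) (x ∷ v) ⇔ Adj u v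
adj-same x u v = mk⇔ to from
  where
  to : Adj (x ∷ u) (x ∷ v) → Adj u v
  to (zero  , _ , x≢x , _)   = contradiction refl x≢x
  to (suc h , before , differ , after) =
    h , (λ i i<h → before (suc i) (s≤s i<h)) , differ , (λ j h<j → after (suc j) (s≤s h<j))
  from : Adj u v → Adj (x ∷ u) (x ∷ v)
  from (h , before , differ , after) = suc h , before′ , differ , after′
    where
    before′ : ∀ i → toℕ i < suc (toℕ h) → lookup (x ∷ u) i ≡ lookup (x ∷ v) i
    before′ zero    _         = refl
    before′ (suc i) (s≤s i<h) = before i i<h
    after′ : ∀ j → suc (toℕ h) < toℕ j →
      (lookup (x ∷ u) j ≡ lookup v h) × (lookup (x ∷ v) j ≡ lookup u h)
    after′ (suc j) (s≤s h<j) = after j h<j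

lookup-const⇒corner : ∀ {n m} {y : Fin m} (u : Vertex n m) → (∀ j → lookup u j ≡ y) → u ≡ corner n y
lookup-const⇒corner []      _     = refl
lookup-const⇒corner (z ∷ u) const = cong₂ _∷_ (const zero) (lookup-const⇒corner u (const ∘ suc))

-- Different first letters force `h` to be the first position, and the swap condition then fixes all
-- later letters.
adj-different : ∀ {n m} {x y : Fin m} (u v : Vertex n m) → x ≢ y →
  Adj (x ∷ u) (y ∷ v) ⇔ ((u ≡ corner n y) × (v ≡ corner n x))
adj-different {n} {m} {x} {y} u v x≢y = mk⇔ to from
  where
  to : Adj (x ∷ u) (y ∷ v) → (u ≡ corner n y) × (v ≡ corner n x)
  to (zero  , _ , _ , after) =
    lookup-const⇒corner u (λ j → proj₁ (after (suc j) (s≤s z≤n))) ,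
    lookup-const⇒corner v (λ j → proj₂ (after (suc j) (s≤s z≤n)))
  to (suc h , before , _)    = contradiction (before zero (s≤s z≤n)) x≢y
  from : (u ≡ corner n y) × (v ≡ corner n x) → Adj (x ∷ u) (y ∷ v)
  from (refl , refl) = zero , (λ _ ()) , x≢y , after
    where
    after : ∀ j → 0 < toℕ j →
      (lookup (x ∷ corner n y) j ≡ y) × (lookup (y ∷ corner n x) j ≡ x)
    after (suc j) _ = lookup-replicate j y , lookup-replicate j x

Matrix : ℕ → Set
Matrix m = Fin m → Fin m → Bool

-- The edge between copies `x` and `y` joins the entries `(x,y)` and `(y,x)`; the diagonal entries
-- are the corners of the whole graph.
cornerMatrix : ∀ {n m} → VSet (suc n) m → Matrix m
cornerMatrix {n} S x y = S (x ∷ corner n y)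

exits : Bool → Bool → ℕ
exits b c = ⟦ b ∧ not c ⟧

cross : ∀ {m} → Matrix m → ℕ
cross {m} M = ∑[ x < m ] ∑[ y < m ] exits (M x y) (M y x)

exits-diag : ∀ b → exits b b ≡ 0
exits-diag true  = refl
exits-diag false = refl

-- Sort the ordered pairs of vertices by their first letters: a diagonal block is a copy of the
-- smaller graph, an off-diagonal block holds a single edge.
Θ-suc : ∀ {n m} (S : VSet (suc n) m) → Θ S ≡ ∑[ x < m ] Θ (copy S x) + cross (cornerMatrix S)
Θ-suc {n} {m} S = begin
  Θ S
    ≡⟨ Θ≡∑v S ⟩
  ∑v (λ u → ∑v (crossing S S u))
    ≡⟨ ∑v-suc (λ u → ∑v (crossing S S u)) ⟩
  ∑[ x < m ] ∑v (λ u → ∑v (crossing S S (x ∷ u)))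
    ≡⟨ sum-cong-≗ (λ x → weight-cong (λ u → ∑v-suc (crossing S S (x ∷ u))) V) ⟩
  ∑[ x < m ] ∑v (λ u → ∑[ y < m ] ∑v (λ v → crossing S S (x ∷ u) (y ∷ v)))
    ≡⟨ sum-cong-≗ (λ x → ∑v-sum (λ u y → ∑v (λ v → crossing S S (x ∷ u) (y ∷ v))) V) ⟩
  ∑[ x < m ] ∑[ y < m ] ∑v (λ u → ∑v (λ v → crossing S S (x ∷ u) (y ∷ v)))
    ≡⟨ sum-cong-≗ (λ x → trans (sum-cong-≗ (block x)) (∑-distrib-+ (λ y → at x y (Θ (copy S x))) (λ y → exits (M x y) (M y x)))) ⟩
  ∑[ x < m ] (∑[ y < m ] at x y (Θ (copy S x)) + ∑[ y < m ] exits (M x y) (M y x))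
    ≡⟨ sum-cong-≗ (λ x → cong (_+ ∑[ y < m ] exits (M x y) (M y x)) (sum-at x (λ _ → Θ (copy S x)))) ⟩
  ∑[ x < m ] (Θ (copy S x) + ∑[ y < m ] exits (M x y) (M y x))
    ≡⟨ ∑-distrib-+ (λ x → Θ (copy S x)) (λ x → ∑[ y < m ] exits (M x y) (M y x)) ⟩
  ∑[ x < m ] Θ (copy S x) + cross M ∎
  where
  open ≡-Reasoning
  V = allVertices n m
  M = cornerMatrix S

  ∑v-sum : ∀ {A : Set} (w : A → Fin m → ℕ) (xs : List A) →
    weight (λ u → sum (w u)) xs ≡ ∑[ y < m ] weight (λ u → w u y) xs
  ∑v-sum w []       = sym (sum-replicate-zero m)
  ∑v-sum w (u ∷ us) = trans (cong (sum (w u) +_) (∑v-sum w us)) (sym (∑-distrib-+ (w u) _))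

  split-∧ : ∀ b c d → ⟦ b ∧ (c ∧ d) ⟧ ≡ (if c then (if d then ⟦ b ⟧ else 0) else 0)
  split-∧ true  true  true  = refl
  split-∧ true  true  false = refl
  split-∧ true  false d     = refl
  split-∧ false true  true  = refl
  split-∧ false true  false = refl
  split-∧ false false d     = refl

  -- One formula serves both kinds of block: `exits` vanishes for `y = x`, and `at` vanishes
  -- otherwise.
  block : ∀ x y → ∑v (λ u → ∑v (λ v → crossing S S (x ∷ u) (y ∷ v))) ≡
    at x y (Θ (copy S x)) + exits (M x y) (M y x)
  block x y with y ≟ x
  ... | yes refl = begin
    ∑v (λ u → ∑v (λ v → crossing S S (x ∷ u) (x ∷ v)))
      ≡⟨ weight-cong (λ u → weight-cong (λ v → cong (λ b → ⟦ (S (x ∷ u) ∧ not (S (x ∷ v))) ∧ b ⟧)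
           (does-⇔ (adj-same x u v) (adj? (x ∷ u) (x ∷ v)) (adj? u v))) V) V ⟩
    ∑v (λ u → ∑v (crossing (copy S x) (copy S x) u))
      ≡⟨ Θ≡∑v (copy S x) ⟨
    Θ (copy S x)
      ≡⟨ trans (cong (Θ (copy S x) +_) (exits-diag (M x x))) (+-identityʳ _) ⟨
    Θ (copy S x) + exits (M x x) (M x x) ∎
  ... | no y≢x = begin
    ∑v (λ u → ∑v (λ v → crossing S S (x ∷ u) (y ∷ v)))
      ≡⟨ weight-cong (λ u → weight-cong (λ v → trans (cong (λ b → ⟦ (S (x ∷ u) ∧ not (S (y ∷ v))) ∧ b ⟧)
           (does-⇔ (adj-different u v (y≢x ∘ sym)) (adj? (x ∷ u) (y ∷ v)) ((u ≟v corner n y) ×-dec (v ≟v corner n x))))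
           (split-∧ _ (does (u ≟v corner n y)) (does (v ≟v corner n x)))) V) V ⟩
    ∑v (λ u → ∑v (λ v → if does (u ≟v corner n y) then (if does (v ≟v corner n x) then ⟦ S (x ∷ u) ∧ not (S (y ∷ v)) ⟧ else 0) else 0))
      ≡⟨ weight-cong inner V ⟩
    ∑v (λ u → if does (u ≟v corner n y) then ⟦ S (x ∷ u) ∧ not (M y x) ⟧ else 0)
      ≡⟨ ∑v-at (corner n y) (λ u → ⟦ S (x ∷ u) ∧ not (M y x) ⟧) ⟩
    exits (M x y) (M y x) ∎
    where
    inner : ∀ u →
      ∑v (λ v → if does (u ≟v corner n y) then (if does (v ≟v corner n x) then ⟦ S (x ∷ u) ∧ not (S (y ∷ v)) ⟧ else 0) else 0)
      ≡ (if does (u ≟v corner n y) then ⟦ S (x ∷ u) ∧ not (M y x) ⟧ else 0)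
    inner u with does (u ≟v corner n y)
    ... | true  = ∑v-at (corner n x) (λ v → ⟦ S (x ∷ u) ∧ not (S (y ∷ v)) ⟧)
    ... | false = weight-zero (λ _ → refl) V

-- The edges between the copies

∑∑ : ∀ {m} → (Fin m → Fin m → ℕ) → ℕ
∑∑ {m} f = ∑[ x < m ] ∑[ y < m ] f x y

∑∑-cong : ∀ {m} {f g : Fin m → Fin m → ℕ} → (∀ x y → f x y ≡ g x y) → ∑∑ f ≡ ∑∑ g
∑∑-cong f≗g = sum-cong-≗ λ x → sum-cong-≗ (f≗g x)

∑∑-mono-≤ : ∀ {m} {f g : Fin m → Fin m → ℕ} → (∀ x y → f x y ≤ g x y) → ∑∑ f ≤ ∑∑ g
∑∑-mono-≤ f≤g = sum-mono-≤ λ x → sum-mono-≤ (f≤g x)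

∑∑-distrib-+ : ∀ {m} (f g : Fin m → Fin m → ℕ) → ∑∑ (λ x y → f x y + g x y) ≡ ∑∑ f + ∑∑ g
∑∑-distrib-+ f g = trans (sum-cong-≗ λ x → ∑-distrib-+ (f x) (g x)) (∑-distrib-+ (λ x → sum (f x)) (λ x → sum (g x)))

sum-at-const : ∀ {m} (a x : Fin m) (g : Fin m → ℕ) → ∑[ y < m ] at a x (g y) ≡ at a x (sum g)
sum-at-const {m} a x g with does (x ≟ a)
... | true  = refl
... | false = sum-replicate-zero m

∑∑-at-row : ∀ {m} (a : Fin m) (g : Fin m → ℕ) → ∑∑ (λ x y → at a x (g y)) ≡ sum g
∑∑-at-row a g = trans (sum-cong-≗ λ x → sum-at-const a x g) (sum-at a (λ _ → sum g))

∑∑-at-column : ∀ {m} (a : Fin m) (g : Fin m → ℕ) → ∑∑ (λ x y → at a y (g x)) ≡ sum g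
∑∑-at-column a g = sum-cong-≗ λ x → sum-at a (λ _ → g x)

-- `exits` is the truncated difference of two bits, hence a directed distance; the path runs from
-- `b′` over `b` and `c` to `c′`.
exits-triangle : ∀ b c b′ c′ → exits b′ c′ ≤ exits b c + (exits b′ b + exits c c′)
exits-triangle b     c     false c′    = z≤n
exits-triangle b     c     true  true  = z≤n
exits-triangle false c     true  false = s≤s z≤n
exits-triangle true  false true  false = s≤s z≤n
exits-triangle true  true  true  false = s≤s z≤n

exits-sym : ∀ b b′ → exits b′ b + exits b b′ ≡ ⟦ b xor b′ ⟧
exits-sym false false = refl
exits-sym false true  = refl
exits-sym true  false = refl
exits-sym true  true  = refl

-- An off-diagonal entry is an endpoint of one edge, so flipping it changes `cross` by at most one.
-- Diagonal entries touch no edge between copies; their flips therefore also stand on the left,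
-- where they later pay for the change in the number of corners.
cross-lipschitz : ∀ {m} (M M′ : Matrix m) →
  cross M′ + ∑[ x < m ] ⟦ M x x xor M′ x x ⟧ ≤ cross M + ∑[ x < m ] ∑[ y < m ] ⟦ M x y xor M′ x y ⟧
cross-lipschitz {m} M M′ = begin
  cross M′ + ∑[ x < m ] ⟦ M x x xor M′ x x ⟧
    ≡⟨ cong (cross M′ +_) (sum-cong-≗ λ x → sum-at x (λ y → ⟦ M y y xor M′ y y ⟧)) ⟨
  cross M′ + ∑∑ (λ x y → at x y ⟦ M y y xor M′ y y ⟧)
    ≡⟨ ∑∑-distrib-+ (λ x y → exits (M′ x y) (M′ y x)) (λ x y → at x y ⟦ M y y xor M′ y y ⟧) ⟨
  ∑∑ (λ x y → exits (M′ x y) (M′ y x) + at x y ⟦ M y y xor M′ y y ⟧)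
    ≤⟨ ∑∑-mono-≤ pointwise ⟩
  ∑∑ (λ x y → exits (M x y) (M y x) + (exits (M′ x y) (M x y) + exits (M y x) (M′ y x)))
    ≡⟨ ∑∑-distrib-+ (λ x y → exits (M x y) (M y x)) (λ x y → exits (M′ x y) (M x y) + exits (M y x) (M′ y x)) ⟩
  cross M + ∑∑ (λ x y → exits (M′ x y) (M x y) + exits (M y x) (M′ y x))
    ≡⟨ cong (cross M +_) (∑∑-distrib-+ (λ x y → exits (M′ x y) (M x y)) (λ x y → exits (M y x) (M′ y x))) ⟩
  cross M + (∑∑ (λ x y → exits (M′ x y) (M x y)) + ∑∑ (λ x y → exits (M y x) (M′ y x)))
    -- After transposing, the two directed distances of the same entry stand together and add up to
    -- the indicator of a flip.
    ≡⟨ cong (λ s → cross M + (∑∑ (λ x y → exits (M′ x y) (M x y)) + s)) (∑-comm (λ x y → exits (M y x) (M′ y x))) ⟩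
  cross M + (∑∑ (λ x y → exits (M′ x y) (M x y)) + ∑∑ (λ x y → exits (M x y) (M′ x y)))
    ≡⟨ cong (cross M +_) (∑∑-distrib-+ (λ x y → exits (M′ x y) (M x y)) (λ x y → exits (M x y) (M′ x y))) ⟨
  cross M + ∑∑ (λ x y → exits (M′ x y) (M x y) + exits (M x y) (M′ x y))
    ≡⟨ cong (cross M +_) (∑∑-cong λ x y → exits-sym (M x y) (M′ x y)) ⟩
  cross M + ∑[ x < m ] ∑[ y < m ] ⟦ M x y xor M′ x y ⟧ ∎
  where
  open ≤-Reasoning
  pointwise : ∀ x y → exits (M′ x y) (M′ y x) + at x y ⟦ M y y xor M′ y y ⟧ ≤
    exits (M x y) (M y x) + (exits (M′ x y) (M x y) + exits (M y x) (M′ y x))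
  pointwise x y with y ≟ x
  ... | no  _    = ≤-trans (≤-reflexive (+-identityʳ _)) (exits-triangle (M x y) (M y x) (M′ x y) (M′ y x))
  ... | yes refl = begin
    exits (M′ x x) (M′ x x) + ⟦ M x x xor M′ x x ⟧ ≡⟨ cong₂ _+_ (exits-diag (M′ x x)) (sym (exits-sym (M x x) (M′ x x))) ⟩
    exits (M′ x x) (M x x) + exits (M x x) (M′ x x) ≤⟨ m≤n+m _ (exits (M x x) (M x x)) ⟩
    exits (M x x) (M x x) + (exits (M′ x x) (M x x) + exits (M x x) (M′ x x)) ∎

-- Matrices whose rows are constant except for one

rows : ∀ {m} → Fin m → (Fin m → Bool) → (Fin m → Bool) → Matrix m
rows a A f x y = if does (x ≟ a) then A y else f x

size : ∀ {m} → (Fin m → Bool) → ℕ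
size {m} f = ∑[ x < m ] ⟦ f x ⟧

size-not : ∀ {m} (f : Fin m → Bool) → ∑[ x < m ] ⟦ not (f x) ⟧ ≡ m ∸ size f
size-not {m} f = begin
  ∑[ x < m ] ⟦ not (f x) ⟧                         ≡⟨ m+n∸n≡m _ (size f) ⟨
  ∑[ x < m ] ⟦ not (f x) ⟧ + size f ∸ size f       ≡⟨ cong (_∸ size f) (∑-distrib-+ (λ x → ⟦ not (f x) ⟧) (λ x → ⟦ f x ⟧)) ⟨
  ∑[ x < m ] (⟦ not (f x) ⟧ + ⟦ f x ⟧) ∸ size f    ≡⟨ cong (_∸ size f) (sum-cong-≗ λ x → complement (f x)) ⟩
  ∑[ _ < m ] 1 ∸ size f                            ≡⟨ cong (_∸ size f) (trans (sum-const m 1) (*-identityʳ m)) ⟩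
  m ∸ size f                                       ∎
  where
  open ≡-Reasoning
  complement : ∀ b → ⟦ not b ⟧ + ⟦ b ⟧ ≡ 1
  complement true  = refl
  complement false = refl

∑∑-exits : ∀ {m} (f : Fin m → Bool) → ∑∑ (λ x y → exits (f x) (f y)) ≡ size f * (m ∸ size f)
∑∑-exits {m} f = begin
  ∑[ x < m ] ∑[ y < m ] exits (f x) (f y)            ≡⟨ ∑∑-cong (λ x y → product (f x) (f y)) ⟩
  ∑[ x < m ] ∑[ y < m ] (⟦ f x ⟧ * ⟦ not (f y) ⟧)    ≡⟨ sum-cong-≗ (λ x → *-distribˡ-sum ⟦ f x ⟧ (λ y → ⟦ not (f y) ⟧)) ⟨
  ∑[ x < m ] (⟦ f x ⟧ * ∑[ y < m ] ⟦ not (f y) ⟧)    ≡⟨ *-distribʳ-sum (∑[ y < m ] ⟦ not (f y) ⟧) (λ x → ⟦ f x ⟧) ⟨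
  size f * ∑[ y < m ] ⟦ not (f y) ⟧                  ≡⟨ cong (size f *_) (size-not f) ⟩
  size f * (m ∸ size f)                              ∎
  where
  open ≡-Reasoning
  product : ∀ b c → exits b c ≡ ⟦ b ⟧ * ⟦ not c ⟧
  product true  true  = refl
  product true  false = refl
  product false c     = refl

-- The cardinality of a set difference.
leaving : ∀ {m} → (Fin m → Bool) → (Fin m → Bool) → ℕ
leaving {m} A f = ∑[ y < m ] exits (A y) (f y)

-- Both sides count the union of the two sets.
size+leaving : ∀ {m} (A f : Fin m → Bool) → size A + leaving f A ≡ size f + leaving A f
size+leaving A f = trans (sym (∑-distrib-+ (λ y → ⟦ A y ⟧) (λ y → exits (f y) (A y))))
  (trans (sum-cong-≗ λ y → pointwise (A y) (f y)) (∑-distrib-+ (λ y → ⟦ f y ⟧) (λ y → exits (A y) (f y))))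
  where
  pointwise : ∀ b c → ⟦ b ⟧ + exits c b ≡ ⟦ c ⟧ + exits b c
  pointwise true  true  = refl
  pointwise true  false = refl
  pointwise false true  = refl
  pointwise false false = refl

-- Were copy `a` empty, each of the `size f` full copies would send an edge to each of the other
-- copies. The true row `a` replaces the `size f` edges into copy `a` by the two set differences,
-- the first of which also counts the diagonal entry `A a`. The corrections stand on the left to
-- avoid subtraction.
cross-rows : ∀ {m} (a : Fin m) (A f : Fin m → Bool) → f a ≡ false →
  cross (rows a A f) + (size f + ⟦ A a ⟧) ≡ size f * (m ∸ size f) + (leaving A f + leaving f A)
cross-rows {m} a A f fa≡false = begin
  cross R + (size f + ⟦ A a ⟧)
    ≡⟨ cong (cross R +_) (cong₂ _+_ (∑∑-at-column a (λ x → ⟦ f x ⟧)) (trans (∑∑-at-row a (λ y → at a y ⟦ A y ⟧)) (sum-at a (λ y → ⟦ A y ⟧)))) ⟨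
  cross R + (∑∑ (λ x y → at a y ⟦ f x ⟧) + ∑∑ (λ x y → at a x (at a y ⟦ A y ⟧)))
    ≡⟨ cong (cross R +_) (∑∑-distrib-+ (λ x y → at a y ⟦ f x ⟧) (λ x y → at a x (at a y ⟦ A y ⟧))) ⟨
  cross R + ∑∑ (λ x y → at a y ⟦ f x ⟧ + at a x (at a y ⟦ A y ⟧))
    ≡⟨ ∑∑-distrib-+ (λ x y → exits (R x y) (R y x)) (λ x y → at a y ⟦ f x ⟧ + at a x (at a y ⟦ A y ⟧)) ⟨
  ∑∑ (λ x y → exits (R x y) (R y x) + (at a y ⟦ f x ⟧ + at a x (at a y ⟦ A y ⟧)))
    ≡⟨ ∑∑-cong pointwise ⟩
  ∑∑ (λ x y → exits (f x) (f y) + (at a x (exits (A y) (f y)) + at a y (exits (f x) (A x))))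
    ≡⟨ ∑∑-distrib-+ (λ x y → exits (f x) (f y)) (λ x y → at a x (exits (A y) (f y)) + at a y (exits (f x) (A x))) ⟩
  ∑∑ (λ x y → exits (f x) (f y)) + ∑∑ (λ x y → at a x (exits (A y) (f y)) + at a y (exits (f x) (A x)))
    ≡⟨ cong₂ _+_ (∑∑-exits f) (∑∑-distrib-+ (λ x y → at a x (exits (A y) (f y))) (λ x y → at a y (exits (f x) (A x)))) ⟩
  size f * (m ∸ size f) + (∑∑ (λ x y → at a x (exits (A y) (f y))) + ∑∑ (λ x y → at a y (exits (f x) (A x))))
    ≡⟨ cong (size f * (m ∸ size f) +_) (cong₂ _+_ (∑∑-at-row a (λ y → exits (A y) (f y))) (∑∑-at-column a (λ x → exits (f x) (A x)))) ⟩
  size f * (m ∸ size f) + (leaving A f + leaving f A) ∎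
  where
  open ≡-Reasoning
  R = rows a A f
  corner-case : ∀ b → exits b b + ⟦ b ⟧ ≡ exits b false + 0
  corner-case true  = refl
  corner-case false = refl
  column-case : ∀ b c → exits b c + (⟦ b ⟧ + 0) ≡ exits b false + exits b c
  column-case true  true  = refl
  column-case true  false = refl
  column-case false c     = refl
  pointwise : ∀ x y →
    exits (R x y) (R y x) + (at a y ⟦ f x ⟧ + at a x (at a y ⟦ A y ⟧)) ≡
    exits (f x) (f y) + (at a x (exits (A y) (f y)) + at a y (exits (f x) (A x)))
  pointwise x y with x ≟ a | y ≟ a
  ... | yes refl | yes refl rewrite fa≡false = corner-case (A a)
  ... | yes refl | no  _    rewrite fa≡false = refl
  ... | no  _    | yes refl rewrite fa≡false = column-case (f x) (A x)
  ... | no  _    | no  _    = refl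

trace-rows : ∀ {m} (a : Fin m) (A f : Fin m → Bool) → f a ≡ false →
  size (λ x → rows a A f x x) ≡ size f + ⟦ A a ⟧
trace-rows {m} a A f fa≡false = begin
  size (λ x → rows a A f x x)                    ≡⟨ sum-cong-≗ pointwise ⟩
  ∑[ x < m ] (⟦ f x ⟧ + at a x ⟦ A x ⟧)          ≡⟨ ∑-distrib-+ (λ x → ⟦ f x ⟧) (λ x → at a x ⟦ A x ⟧) ⟩
  size f + ∑[ x < m ] at a x ⟦ A x ⟧             ≡⟨ cong (size f +_) (sum-at a (λ x → ⟦ A x ⟧)) ⟩
  size f + ⟦ A a ⟧                               ∎
  where
  open ≡-Reasoning
  pointwise : ∀ x → ⟦ rows a A f x x ⟧ ≡ ⟦ f x ⟧ + at a x ⟦ A x ⟧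
  pointwise x with x ≟ a
  ... | yes refl rewrite fa≡false = refl
  ... | no  _    = sym (+-identityʳ _)

∣m-n∣≤o+p : ∀ {m n o p} → m ≤ n + o → n ≤ m + p → ∣ m - n ∣ ≤ o + p
∣m-n∣≤o+p {m} {n} {o} {p} m≤n+o n≤m+p with ≤-total m n
... | inj₁ m≤n = ≤-trans (≤-reflexive (m≤n⇒∣m-n∣≡n∸m m≤n))
      (≤-trans (≤-trans (∸-monoˡ-≤ m n≤m+p) (≤-reflexive (m+n∸m≡n m p))) (m≤n+m p o))
... | inj₂ n≤m = ≤-trans (≤-reflexive (trans (∣-∣-comm m n) (m≤n⇒∣m-n∣≡n∸m n≤m)))
      (≤-trans (≤-trans (∸-monoˡ-≤ n m≤n+o) (≤-reflexive (m+n∸m≡n n o))) (m≤m+n o p))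

-- By `cross-rows` this is a triangle inequality through `size A`: the distance from
-- `size f + ⟦ A a ⟧` to `size A` is at most the size of the symmetric difference less the entry
-- `A a`, by `size+leaving`.
cross-rows-lower : ∀ {m} (a : Fin m) (A f : Fin m → Bool) → f a ≡ false → ∀ k →
  size f * (m ∸ size f) + ∣ size f + ⟦ A a ⟧ - k ∣ ≤ cross (rows a A f) + size f + ∣ size A - k ∣
cross-rows-lower {m} a A f fa≡false k = +-cancelʳ-≤ δ _ _ (begin
  Z + ∣ p + δ - k ∣ + δ                       ≤⟨ +-monoˡ-≤ δ (+-monoʳ-≤ Z (∣-∣-triangle (p + δ) (size A) k)) ⟩
  Z + (∣ p + δ - size A ∣ + ∣ size A - k ∣) + δ  ≤⟨ +-monoˡ-≤ δ (+-monoʳ-≤ Z (+-monoˡ-≤ _ (∣m-n∣≤o+p lower upper))) ⟩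
  Z + (w + (u ∸ δ) + ∣ size A - k ∣) + δ      ≡⟨ rearrange Z w (u ∸ δ) ∣ size A - k ∣ δ ⟩
  Z + (δ + (u ∸ δ) + w) + ∣ size A - k ∣      ≡⟨ cong (λ z → Z + (z + w) + ∣ size A - k ∣) (m+[n∸m]≡n δ≤u) ⟩
  Z + (u + w) + ∣ size A - k ∣                ≡⟨ cong (_+ ∣ size A - k ∣) (cross-rows a A f fa≡false) ⟨
  C + (p + δ) + ∣ size A - k ∣                ≡⟨ rearrange′ C p δ ∣ size A - k ∣ ⟩
  C + p + ∣ size A - k ∣ + δ                  ∎)
  where
  open ≤-Reasoning
  p = size f
  δ = ⟦ A a ⟧
  C = cross (rows a A f)
  Z = p * (m ∸ p)
  u = leaving A f
  w = leaving f A
  -- As `f a` is false, `a` counts towards the difference of `A` and `f` whenever `A a` holds.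
  δ≤u : δ ≤ u
  δ≤u = begin
    ⟦ A a ⟧                            ≡⟨ sum-at a (λ x → ⟦ A x ⟧) ⟨
    ∑[ x < m ] at a x ⟦ A x ⟧          ≤⟨ sum-mono-≤ pointwise ⟩
    u                                  ∎
    where
    pointwise : ∀ x → at a x ⟦ A x ⟧ ≤ exits (A x) (f x)
    pointwise x with x ≟ a
    ... | no  _    = z≤n
    ... | yes refl rewrite fa≡false with A x
    ...   | true  = ≤-refl
    ...   | false = ≤-refl
  lower : p + δ ≤ size A + w
  lower = begin
    p + δ        ≤⟨ +-monoʳ-≤ p δ≤u ⟩
    p + u        ≡⟨ size+leaving A f ⟨
    size A + w   ∎
  upper : size A ≤ p + δ + (u ∸ δ)
  upper = begin
    size A             ≤⟨ m≤m+n (size A) w ⟩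
    size A + w         ≡⟨ size+leaving A f ⟩
    p + u              ≡⟨ cong (p +_) (m+[n∸m]≡n δ≤u) ⟨
    p + (δ + (u ∸ δ))  ≡⟨ +-assoc p δ (u ∸ δ) ⟨
    p + δ + (u ∸ δ)    ∎
  rearrange : ∀ Z w u k δ → Z + (w + u + k) + δ ≡ Z + (δ + u + w) + k
  rearrange = solve-∀
  rearrange′ : ∀ C p δ k → C + (p + δ) + k ≡ C + p + k + δ
  rearrange′ = solve-∀

-- Initial segments of the index set

initial : ∀ {m} → ℕ → Fin m → Bool
initial k i = toℕ i <ᵇ k

size-initial : ∀ {m k} → k ≤ m → size (initial {m} k) ≡ k
size-initial {zero}  z≤n               = refl
size-initial {suc m} z≤n               = sum-replicate-zero m
size-initial {suc m} {suc k} (s≤s k≤m) = cong suc (size-initial k≤m)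

leaving-initial-≤ : ∀ {m k l} → k ≤ l → leaving (initial {m} k) (initial l) ≡ 0
leaving-initial-≤ {m} {k} {l} k≤l = sum-zero pointwise
  where
  pointwise : ∀ (i : Fin m) → exits (initial k i) (initial l i) ≡ 0
  pointwise i with toℕ i <? k
  ... | no  i≮k = cong (λ b → exits b (initial l i)) (dec-false (toℕ i <? k) i≮k)
  ... | yes i<k = trans (cong (exits (initial k i)) (dec-true (toℕ i <? l) (≤-trans i<k k≤l))) (cong ⟦_⟧ (∧-zeroʳ (initial k i)))

leaving-initial-≥ : ∀ {m k l} → k ≤ l → l ≤ m → leaving (initial {m} l) (initial k) ≡ l ∸ k
leaving-initial-≥ {m} {k} {l} k≤l l≤m = begin
  leaving L K                 ≡⟨ m+n∸m≡n k (leaving L K) ⟨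
  k + leaving L K ∸ k         ≡⟨ cong (λ z → z + leaving L K ∸ k) (size-initial (≤-trans k≤l l≤m)) ⟨
  size K + leaving L K ∸ k    ≡⟨ cong (_∸ k) (size+leaving K L) ⟩
  size L + leaving K L ∸ k    ≡⟨ cong (_∸ k) (cong₂ _+_ (size-initial l≤m) (leaving-initial-≤ {m} k≤l)) ⟩
  l + 0 ∸ k                   ≡⟨ cong (_∸ k) (+-identityʳ l) ⟩
  l ∸ k                       ∎
  where
  open ≡-Reasoning
  K = initial {m} k
  L = initial {m} l

leaving-initial : ∀ {m k l} → k ≤ m → l ≤ m →
  leaving (initial {m} k) (initial l) + leaving (initial {m} l) (initial k) ≡ ∣ l - k ∣
leaving-initial {m} {k} {l} k≤m l≤m with ≤-total k l
... | inj₁ k≤l = trans (cong₂ _+_ (leaving-initial-≤ {m} k≤l) (leaving-initial-≥ {m} k≤l l≤m))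
                       (sym (trans (∣-∣-comm l k) (m≤n⇒∣m-n∣≡n∸m k≤l)))
... | inj₂ l≤k = trans (cong₂ _+_ (leaving-initial-≥ {m} l≤k k≤m) (leaving-initial-≤ {m} l≤k))
                       (trans (+-identityʳ (k ∸ l)) (sym (m≤n⇒∣m-n∣≡n∸m l≤k)))

-- In fact both sides agree: for p < k both are k - p + 1 - b, otherwise both are p - k + b, with b
-- read as 0 or 1.
∣-∣-indicator : ∀ p k b → ∣ p - k ∣ + ∣ p + ⟦ b ⟧ - (p + ⟦ p <ᵇ k ⟧) ∣ ≤ ∣ p + ⟦ b ⟧ - k ∣ + ⟦ p <ᵇ k ⟧
∣-∣-indicator zero    zero          b     = ≤-reflexive (trans (∣-∣-identityʳ ⟦ b ⟧) (sym (trans (+-identityʳ _) (∣-∣-identityʳ ⟦ b ⟧))))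
∣-∣-indicator zero    (suc k)       true  = ≤-reflexive (trans (+-identityʳ (suc k)) (+-comm 1 k))
∣-∣-indicator zero    (suc k)       false = ≤-refl
∣-∣-indicator (suc p) zero          b     = ≤-reflexive (cong suc (trans (cong (p +_) (trans (∣m+n-m+o∣≡∣n-o∣ p ⟦ b ⟧ 0) (∣-∣-identityʳ ⟦ b ⟧)))
  (sym (+-identityʳ (p + ⟦ b ⟧)))))
∣-∣-indicator (suc p) (suc k)       b     = ∣-∣-indicator p k b

-- The counterpart of `cross-rows-lower` for the matrix of a lexicographic segment. Its pivot row
-- and its set of full copies are both initial, hence nested; their symmetric difference has size |p
-- - k|, which makes `cross` explicit.
cross-rows-initial : ∀ {m} (a : Fin m) {k} → k ≤ m → ∀ b → let p = toℕ a in
  cross (rows a (initial k) (initial p)) + p + ∣ p + ⟦ b ⟧ - (p + ⟦ p <ᵇ k ⟧) ∣ ≤ p * (m ∸ p) + ∣ p + ⟦ b ⟧ - k ∣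
cross-rows-initial {m} a {k} k≤m b = +-cancelʳ-≤ ε _ _ (begin
  C + p + D + ε                      ≡⟨ rearrange C p D ε ⟩
  C + (p + ε) + D                    ≡⟨ cong (_+ D) exact ⟩
  p * (m ∸ p) + ∣ p - k ∣ + D        ≡⟨ +-assoc (p * (m ∸ p)) _ _ ⟩
  p * (m ∸ p) + (∣ p - k ∣ + D)      ≤⟨ +-monoʳ-≤ (p * (m ∸ p)) (∣-∣-indicator p k b) ⟩
  p * (m ∸ p) + (∣ p + ⟦ b ⟧ - k ∣ + ε)  ≡⟨ +-assoc (p * (m ∸ p)) _ _ ⟨
  p * (m ∸ p) + ∣ p + ⟦ b ⟧ - k ∣ + ε    ∎)
  where
  open ≤-Reasoning
  p = toℕ a
  p≤m = <⇒≤ (toℕ<n a)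
  ε = ⟦ p <ᵇ k ⟧
  C = cross (rows a (initial k) (initial p))
  D = ∣ p + ⟦ b ⟧ - (p + ε) ∣
  rearrange : ∀ C p D ε → C + p + D + ε ≡ C + (p + ε) + D
  rearrange = solve-∀
  exact : C + (p + ε) ≡ p * (m ∸ p) + ∣ p - k ∣
  exact = begin-equality
    C + (p + ε)
      ≡⟨ cong (λ z → C + (z + ε)) (size-initial p≤m) ⟨
    C + (size (initial {m} p) + ε)
      ≡⟨ cross-rows a (initial k) (initial p) (dec-false (p <? p) (<-irrefl refl)) ⟩
    size (initial {m} p) * (m ∸ size (initial {m} p)) + (leaving (initial {m} k) (initial p) + leaving (initial {m} p) (initial k))
      ≡⟨ cong₂ _+_ (cong (λ z → z * (m ∸ z)) (size-initial p≤m)) (leaving-initial {m} k≤m p≤m) ⟩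
    p * (m ∸ p) + ∣ p - k ∣ ∎

-- Initial segments of the lexicographic order

does-true : {P : Set} (P? : Dec P) → does P? ≡ true → P
does-true (yes p) _ = p

does-false : {P : Set} (P? : Dec P) → does P? ≡ false → ¬ P
does-false (no ¬p) _ = ¬p

-- If the least index is missing, downward closure empties the set; otherwise induction applies to
-- the remaining indices.
downwardClosed⇒initial : ∀ {m} (f : Fin m → Bool) → (∀ i j → toℕ i ≤ toℕ j → f j ≡ true → f i ≡ true) →
  ∀ i → f i ≡ initial (size f) i
downwardClosed⇒initial {suc m} f closed i with f zero in f₀
... | true  = below i
  where
  below : ∀ i → f i ≡ initial (suc (size (f ∘ suc))) i
  below zero    = f₀
  below (suc i) = downwardClosed⇒initial (f ∘ suc) (λ i j i≤j → closed (suc i) (suc j) (s≤s i≤j)) i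
... | false = trans (empty i) (cong (λ k → initial k i) (sym (sum-zero λ j → cong ⟦_⟧ (empty (suc j)))))
  where
  empty : ∀ j → f j ≡ false
  empty j with f j in fj
  ... | false = refl
  ... | true  = contradiction (trans (sym f₀) (closed zero j z≤n fj)) λ ()

lexSum-corner-mono : ∀ n {m} {i j : Fin m} → toℕ i ≤ toℕ j → lexSum (corner n i) ≤ lexSum (corner n j)
lexSum-corner-mono zero        i≤j = z≤n
lexSum-corner-mono (suc n) {m} i≤j = +-mono-≤ (*-monoˡ-≤ (m ^ n) i≤j) (lexSum-corner-mono n i≤j)

q≡size : ∀ n m ℓ → q n m ℓ ≡ size (λ i → Lex⁻¹ n m ℓ (corner n i))
q≡size n m ℓ = count-allFin (λ (i : Fin m) → T? (Lex (corner n i) ≤ᵇ ℓ))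

-- Corners come in the order of their letters, so a segment contains those with the smallest
-- letters.
Lex⁻¹-corner : ∀ n m ℓ (i : Fin m) → Lex⁻¹ n m ℓ (corner n i) ≡ initial (q n m ℓ) i
Lex⁻¹-corner n m ℓ i = trans (downwardClosed⇒initial (λ i → Lex⁻¹ n m ℓ (corner n i)) closed i)
  (cong (λ k → initial k i) (sym (q≡size n m ℓ)))
  where
  closed : ∀ (i j : Fin m) → toℕ i ≤ toℕ j → Lex⁻¹ n m ℓ (corner n j) ≡ true → Lex⁻¹ n m ℓ (corner n i) ≡ true
  closed i j i≤j j∈ = dec-true (Lex (corner n i) ≤? ℓ)
    (≤-trans (s≤s (lexSum-corner-mono n i≤j)) (does-true (Lex (corner n j) ≤? ℓ) j∈))

size≤ : ∀ {m} (f : Fin m → Bool) → size f ≤ m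
size≤ {m} f = ≤-trans (sum-mono-≤ λ i → ⟦⟧≤1 (f i)) (≤-reflexive (trans (sum-const m 1) (*-identityʳ m)))

q≤m : ∀ n m ℓ → q n m ℓ ≤ m
q≤m n m ℓ = ≤-trans (≤-reflexive (q≡size n m ℓ)) (size≤ (λ i → Lex⁻¹ n m ℓ (corner n i)))

q-mono-≤ : ∀ n m {ℓ ℓ′} → ℓ ≤ ℓ′ → q n m ℓ ≤ q n m ℓ′
q-mono-≤ n m {ℓ} {ℓ′} ℓ≤ℓ′ = begin
  q n m ℓ                                    ≡⟨ q≡size n m ℓ ⟩
  size (λ i → Lex⁻¹ n m ℓ (corner n i))      ≤⟨ sum-mono-≤ pointwise ⟩
  size (λ i → Lex⁻¹ n m ℓ′ (corner n i))     ≡⟨ q≡size n m ℓ′ ⟨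
  q n m ℓ′                                   ∎
  where
  open ≤-Reasoning
  pointwise : ∀ i → ⟦ Lex⁻¹ n m ℓ (corner n i) ⟧ ≤ ⟦ Lex⁻¹ n m ℓ′ (corner n i) ⟧
  pointwise i with Lex⁻¹ n m ℓ (corner n i) in i∈
  ... | false = z≤n
  ... | true  = ≤-reflexive (cong ⟦_⟧ (sym (dec-true (Lex (corner n i) ≤? ℓ′)
                  (≤-trans (does-true (Lex (corner n i) ≤? ℓ) i∈) ℓ≤ℓ′))))

lexSum< : ∀ {n m} (v : Vertex n m) → lexSum v < m ^ n
lexSum<         []      = s≤s z≤n
lexSum< {suc n} {m} (x ∷ v) = begin-strict
  toℕ x * m ^ n + lexSum v  <⟨ +-monoʳ-< (toℕ x * m ^ n) (lexSum< v) ⟩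
  toℕ x * m ^ n + m ^ n     ≡⟨ +-comm (toℕ x * m ^ n) (m ^ n) ⟩
  suc (toℕ x) * m ^ n       ≤⟨ *-monoˡ-≤ (m ^ n) (toℕ<n x) ⟩
  m * m ^ n                 ∎
  where open ≤-Reasoning

Lex⁻¹-full : ∀ n m (v : Vertex n m) → Lex⁻¹ n m (m ^ n) v ≡ true
Lex⁻¹-full n m v = dec-true (Lex v ≤? m ^ n) (lexSum< v)

Θ-Lex⁻¹-full : ∀ n m → Θ (Lex⁻¹ n m (m ^ n)) ≡ 0
Θ-Lex⁻¹-full n m = trans (Θ-cong (Lex⁻¹-full n m)) (Θ-const {n} {m} true)

Θ-Lex⁻¹-empty : ∀ n m → Θ (Lex⁻¹ n m 0) ≡ 0
Θ-Lex⁻¹-empty n m = Θ-const {n} {m} false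

q-full : ∀ n m → q n m (m ^ n) ≡ m
q-full n m = trans (q≡size n m (m ^ n))
  (trans (sum-cong-≗ λ i → cong ⟦_⟧ (Lex⁻¹-full n m (corner n i))) (trans (sum-const m 1) (*-identityʳ m)))

q-empty : ∀ n m → q n m 0 ≡ 0
q-empty n m = trans (q≡size n m 0) (sum-replicate-zero m)

rowwise : ∀ n {m} → Fin m → ℕ → Fin m → VSet n m
rowwise n {m} a r x v = if does (x ≟ a) then Lex⁻¹ n m r v else initial (toℕ a) x

-- The first letter is the leading base-`m` digit. Words after copy `a` have `lexSum` at least
-- `suc (toℕ a) * m ^ n`, so `r` may even equal `m ^ n`.
Lex⁻¹-suc : ∀ n {m} (a : Fin m) {r} → r ≤ m ^ n → ∀ x (v : Vertex n m) →
  Lex⁻¹ (suc n) m (toℕ a * m ^ n + r) (x ∷ v) ≡ rowwise n a r x v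
Lex⁻¹-suc n {m} a {r} r≤N x v with x ≟ a
... | yes refl = does-⇔ (mk⇔ (λ h → +-cancelˡ-≤ (toℕ a * N) _ _ (≤-trans (≤-reflexive (+-suc (toℕ a * N) (lexSum v))) h))
                             (λ h → ≤-trans (≤-reflexive (sym (+-suc (toℕ a * N) (lexSum v)))) (+-monoʳ-≤ (toℕ a * N) h)))
                        (suc (toℕ a * N + lexSum v) ≤? toℕ a * N + r) (suc (lexSum v) ≤? r)
  where N = m ^ n
... | no x≢a = does-⇔ (mk⇔ to from) (suc (toℕ x * N + lexSum v) ≤? toℕ a * N + r) (toℕ x <? toℕ a)
  where
  open ≤-Reasoning
  N = m ^ n
  to : suc (toℕ x * N + lexSum v) ≤ toℕ a * N + r → toℕ x < toℕ a
  to h with toℕ x <? toℕ a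
  ... | yes x<a = x<a
  ... | no  x≮a = contradiction h (<⇒≱ (s≤s (begin
    toℕ a * N + r          ≤⟨ +-monoʳ-≤ (toℕ a * N) r≤N ⟩
    toℕ a * N + N          ≡⟨ +-comm (toℕ a * N) N ⟩
    suc (toℕ a) * N        ≤⟨ *-monoˡ-≤ N (≤∧≢⇒< (≮⇒≥ x≮a) λ a≡x → x≢a (toℕ-injective (sym a≡x))) ⟩
    toℕ x * N              ≤⟨ m≤m+n (toℕ x * N) (lexSum v) ⟩
    toℕ x * N + lexSum v   ∎)))
  from : toℕ x < toℕ a → suc (toℕ x * N + lexSum v) ≤ toℕ a * N + r
  from x<a = begin
    suc (toℕ x * N + lexSum v)   ≤⟨ +-monoʳ-< (toℕ x * N) (lexSum< v) ⟩
    toℕ x * N + N                ≡⟨ +-comm (toℕ x * N) N ⟩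
    suc (toℕ x) * N              ≤⟨ *-monoˡ-≤ N x<a ⟩
    toℕ a * N                    ≤⟨ m≤m+n (toℕ a * N) r ⟩
    toℕ a * N + r                ∎

card-const-true : ∀ n m → card {n} {m} (λ _ → true) ≡ m ^ n
card-const-true zero    m = refl
card-const-true (suc n) m = trans (card-suc {n} {m} (λ _ → true))
  (trans (sum-cong-≗ {m} λ _ → card-const-true n m) (sum-const m (m ^ n)))

card-const-false : ∀ n m → card {n} {m} (λ _ → false) ≡ 0
card-const-false n m = trans (card≡∑v {n} {m} (λ _ → false)) (weight-zero (λ _ → refl) (allVertices n m))

card≤ : ∀ {n m} (S : VSet n m) → card S ≤ m ^ n
card≤ {zero}      S with S []
... | true  = ≤-refl
... | false = z≤n
card≤ {suc n} {m} S = begin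
  card S                          ≡⟨ card-suc S ⟩
  ∑[ x < m ] card (copy S x)      ≤⟨ sum-mono-≤ (λ x → card≤ (copy S x)) ⟩
  ∑[ _ < m ] (m ^ n)              ≡⟨ sum-const m (m ^ n) ⟩
  m * m ^ n                       ∎
  where open ≤-Reasoning

-- The remainder may reach `N`; this keeps the quotient below `m` also for `ℓ = m * N`.
division : ∀ {m} N ℓ → 1 ≤ m → ℓ ≤ m * N → ∃₂ λ (a : Fin m) r → r ≤ N × ℓ ≡ toℕ a * N + r
division {suc m} N ℓ _ ℓ≤ with ℓ ≤? N
... | yes ℓ≤N = zero , ℓ , ℓ≤N , refl
... | no  ℓ≰N with division {m} N (ℓ ∸ N) (1≤m m ℓ≤) (≤-trans (∸-monoˡ-≤ N ℓ≤) (≤-reflexive (m+n∸m≡n N (m * N))))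
  where
  1≤m : ∀ m → ℓ ≤ suc m * N → 1 ≤ m
  1≤m zero    ℓ≤ = contradiction (≤-trans ℓ≤ (≤-reflexive (+-identityʳ N))) ℓ≰N
  1≤m (suc m) _  = s≤s z≤n
... | a , r , r≤N , ℓ∸N≡ = suc a , r , r≤N ,
  trans (sym (m+[n∸m]≡n (<⇒≤ (≰⇒> ℓ≰N)))) (trans (cong (N +_) ℓ∸N≡) (sym (+-assoc N (toℕ a * N) r)))

card-Lex⁻¹ : ∀ n m ℓ → 1 ≤ m → ℓ ≤ m ^ n → card (Lex⁻¹ n m ℓ) ≡ ℓ
card-Lex⁻¹ zero    m zero          _   _   = refl
card-Lex⁻¹ zero    m (suc zero)    _   _   = refl
card-Lex⁻¹ zero    m (suc (suc ℓ)) _   (s≤s ())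
card-Lex⁻¹ (suc n) m ℓ 1≤m ℓ≤ with division {m} (m ^ n) ℓ 1≤m ℓ≤
... | a , r , r≤N , refl = begin
  card (Lex⁻¹ (suc n) m (p * N + r))                       ≡⟨ card-suc (Lex⁻¹ (suc n) m (p * N + r)) ⟩
  ∑[ x < m ] card (copy (Lex⁻¹ (suc n) m (p * N + r)) x)   ≡⟨ sum-cong-≗ (λ x → trans (card-cong (Lex⁻¹-suc n a r≤N x)) (card-rowwise x)) ⟩
  ∑[ x < m ] (⟦ initial p x ⟧ * N + at a x r)              ≡⟨ ∑-distrib-+ (λ x → ⟦ initial p x ⟧ * N) (λ x → at a x r) ⟩
  ∑[ x < m ] (⟦ initial p x ⟧ * N) + ∑[ x < m ] at a x r   ≡⟨ cong₂ _+_ (sym (*-distribʳ-sum N (λ (x : Fin m) → ⟦ initial p x ⟧))) (sum-at a (λ _ → r)) ⟩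
  size (initial {m} p) * N + r                             ≡⟨ cong (λ z → z * N + r) (size-initial (<⇒≤ (toℕ<n a))) ⟩
  p * N + r                                                ∎
  where
  open ≡-Reasoning
  N = m ^ n
  p = toℕ a
  card-rowwise : ∀ x → card (rowwise n a r x) ≡ ⟦ initial p x ⟧ * N + at a x r
  card-rowwise x with x ≟ a
  ... | yes refl = trans (card-Lex⁻¹ n m r 1≤m r≤N)
                         (cong (λ b → ⟦ b ⟧ * N + r) (sym (dec-false (p <? p) (<-irrefl refl))))
  ... | no  _ with initial p x
  ...   | true  = trans (card-const-true n m) (sym (trans (+-identityʳ (N + 0)) (+-identityʳ N)))
  ...   | false = card-const-false n m

-- Full and empty copies have no boundary of their own, so `Θ-suc` leaves the boundary inside copy
-- `a` and `cross R`, which `cross-rows-initial` bounds. The bit `b` is free because it will be a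
-- corner bit of an arbitrary set.
Θ-Lex⁻¹-suc-≤ : ∀ n {m} (a : Fin m) {r} → r ≤ m ^ n → ∀ b → let p = toℕ a; ℓ = p * m ^ n + r in
  Θ (Lex⁻¹ (suc n) m ℓ) + p + ∣ p + ⟦ b ⟧ - q (suc n) m ℓ ∣ ≤
  Θ (Lex⁻¹ n m r) + (p * (m ∸ p) + ∣ p + ⟦ b ⟧ - q n m r ∣)
Θ-Lex⁻¹-suc-≤ n {m} a {r} r≤N b = begin
  Θ S + p + ∣ p + ⟦ b ⟧ - q (suc n) m ℓ ∣                     ≡⟨ cong₂ (λ s t → s + p + ∣ p + ⟦ b ⟧ - t ∣) Θ-S q-S ⟩
  Θ (Lex⁻¹ n m r) + cross R + p + ∣ p + ⟦ b ⟧ - (p + ε) ∣     ≡⟨ rearrange (Θ (Lex⁻¹ n m r)) (cross R) p _ ⟩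
  Θ (Lex⁻¹ n m r) + (cross R + p + ∣ p + ⟦ b ⟧ - (p + ε) ∣)   ≤⟨ +-monoʳ-≤ (Θ (Lex⁻¹ n m r)) (cross-rows-initial a (q≤m n m r) b) ⟩
  Θ (Lex⁻¹ n m r) + (p * (m ∸ p) + ∣ p + ⟦ b ⟧ - q n m r ∣)   ∎
  where
  open ≤-Reasoning
  p = toℕ a
  ℓ = p * m ^ n + r
  S = Lex⁻¹ (suc n) m ℓ
  R = rows a (initial (q n m r)) (initial p)
  ε = ⟦ p <ᵇ q n m r ⟧
  rearrange : ∀ t c p d → t + c + p + d ≡ t + (c + p + d)
  rearrange = solve-∀
  a∉ : initial p a ≡ false
  a∉ = dec-false (p <? p) (<-irrefl refl)
  matrix : ∀ x y → cornerMatrix S x y ≡ R x y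
  matrix x y = trans (Lex⁻¹-suc n a r≤N x (corner n y))
    (cong (λ c → if does (x ≟ a) then c else initial p x) (Lex⁻¹-corner n m r y))
  Θ-rowwise : ∀ x → Θ (rowwise n a r x) ≡ at a x (Θ (Lex⁻¹ n m r))
  Θ-rowwise x with does (x ≟ a)
  ... | true  = refl
  ... | false = Θ-const {n} {m} (initial p x)
  Θ-S : Θ S ≡ Θ (Lex⁻¹ n m r) + cross R
  Θ-S = trans (Θ-suc S) (cong₂ _+_
    (trans (sum-cong-≗ λ x → trans (Θ-cong (Lex⁻¹-suc n a r≤N x)) (Θ-rowwise x)) (sum-at a (λ _ → Θ (Lex⁻¹ n m r))))
    (∑∑-cong λ x y → cong₂ exits (matrix x y) (matrix y x)))
  -- The corners of the larger graph lie on the diagonal of `R`: one for each full copy, and the one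
  -- in copy `a` exactly when `corner n a` lies in the inner segment.
  q-S : q (suc n) m ℓ ≡ p + ε
  q-S = begin-equality
    q (suc n) m ℓ                     ≡⟨ q≡size (suc n) m ℓ ⟩
    size (λ x → cornerMatrix S x x)   ≡⟨ sum-cong-≗ (λ x → cong ⟦_⟧ (matrix x x)) ⟩
    size (λ x → R x x)                ≡⟨ trace-rows a (initial (q n m r)) (initial p) a∉ ⟩
    size (initial {m} p) + ε          ≡⟨ cong (_+ ε) (size-initial (<⇒≤ (toℕ<n a))) ⟩
    p + ε                             ∎

-- Concentrating the mass of a set in few copies

Extreme : ℕ → ℕ → Set
Extreme N x = (x ≡ 0) ⊎ (x ≡ N)

-- `L` and `k` stand for the boundary and the number of corners of a segment of given size. By
-- `cost`, the drop in boundary pays for the change in corners.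
record Merged (N : ℕ) (L k : ℕ → ℕ) (a b : ℕ) : Set where
  field
    a′ b′   : ℕ
    total   : a′ + b′ ≡ a + b
    a′≤N    : a′ ≤ N
    b′≤N    : b′ ≤ N
    extreme : Extreme N a′ ⊎ Extreme N b′
    cost    : L a′ + L b′ + (∣ k a′ - k a ∣ + ∣ k b′ - k b ∣) ≤ L a + L b

merged-refl : ∀ {N L k a b} → a ≤ N → b ≤ N → Extreme N a ⊎ Extreme N b → Merged N L k a b
merged-refl {N} {L} {k} {a} {b} a≤N b≤N ext = record
  { a′ = a ; b′ = b ; total = refl ; a′≤N = a≤N ; b′≤N = b≤N ; extreme = ext
  ; cost = ≤-reflexive (trans (cong (L a + L b +_) (cong₂ _+_ (∣n-n∣≡0 (k a)) (∣n-n∣≡0 (k b)))) (+-identityʳ _))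
  }

merged-swap : ∀ {N L k a b} → Merged N L k a b → Merged N L k b a
merged-swap {N} {L} {k} {a} {b} M = record
  { a′ = b′ ; b′ = a′
  ; total = trans (+-comm b′ a′) (trans total (+-comm a b))
  ; a′≤N = b′≤N ; b′≤N = a′≤N
  ; extreme = swap extreme
  ; cost = ≤-trans (≤-reflexive (cong₂ _+_ (+-comm (L b′) (L a′)) (+-comm ∣ k b′ - k b ∣ ∣ k a′ - k a ∣)))
      (≤-trans cost (≤-reflexive (+-comm (L a) (L b))))
  }
  where open Merged M

Mergeable : ℕ → (ℕ → ℕ) → (ℕ → ℕ) → Set
Mergeable N L k = ∀ a b → b ≤ a → 0 < b → a < N → Merged N L k a b

merge : ∀ {N L k} → Mergeable N L k → ∀ a b → a ≤ N → b ≤ N → Merged N L k a b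
merge {N} {L} {k} mergeable a b a≤N b≤N with extreme? a | extreme? b
  where
  extreme? : ∀ x → Dec (Extreme N x)
  extreme? x = (x ℕ≟ 0) ⊎-dec (x ℕ≟ N)
... | yes ext-a | _ = merged-refl a≤N b≤N (inj₁ ext-a)
... | no _ | yes ext-b = merged-refl a≤N b≤N (inj₂ ext-b)
... | no ¬ext-a | no ¬ext-b with ≤-total b a
...   | inj₁ b≤a = mergeable a b b≤a (n≢0⇒n>0 (¬ext-b ∘ inj₁)) (≤∧≢⇒< a≤N (¬ext-a ∘ inj₂))
...   | inj₂ a≤b = merged-swap (mergeable b a a≤b (n≢0⇒n>0 (¬ext-a ∘ inj₁)) (≤∧≢⇒< b≤N (¬ext-b ∘ inj₂)))

σ-small : ∀ n m a b → a + b < m ^ n → σ n m a b ≡ q n m b + (q n m (a + b) ∸ q n m a)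
σ-small n m a b a+b<N rewrite dec-true (suc (a + b) ≤? m ^ n) a+b<N = refl

σ-large : ∀ n m a b → ¬ a + b < m ^ n → σ n m a b ≡ (q n m b ∸ q n m (a + b ∸ m ^ n)) + (m ∸ q n m a)
σ-large n m a b a+b≮N rewrite dec-false (suc (a + b) ≤? m ^ n) a+b≮N = refl

SubadditiveΘ : ℕ → ℕ → Set
SubadditiveΘ n m = ∀ ℓa ℓb → ℓa ≤ m ^ n → ℓb ≤ ℓa → 0 < ℓb →
  (ℓa + ℓb ≤ m ^ n →
    Θ (Lex⁻¹ n m (ℓa + ℓb)) + σ n m ℓa ℓb ≤ Θ (Lex⁻¹ n m ℓa) + Θ (Lex⁻¹ n m ℓb)) ×
  (m ^ n ≤ ℓa + ℓb →
    Θ (Lex⁻¹ n m (ℓa + ℓb ∸ m ^ n)) + σ n m ℓa ℓb ≤ Θ (Lex⁻¹ n m ℓa) + Θ (Lex⁻¹ n m ℓb))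

-- σ is exactly the total change of the number of corners when the two initial segments are
-- merged, which makes the cost of successive merges add up by the triangle inequality.
Θ-mergeable : ∀ n m → SubadditiveΘ n m → Mergeable (m ^ n) (λ ℓ → Θ (Lex⁻¹ n m ℓ)) (q n m)
Θ-mergeable n m hyp a b b≤a 0<b a<N with a + b <? m ^ n
... | yes a+b<N = record
  { a′ = a + b ; b′ = 0 ; total = +-identityʳ (a + b) ; a′≤N = <⇒≤ a+b<N ; b′≤N = z≤n
  ; extreme = inj₂ (inj₁ refl)
  ; cost = begin
      L (a + b) + L 0 + (∣ k (a + b) - k a ∣ + ∣ k 0 - k b ∣)
        ≡⟨ cong₂ _+_ (trans (cong (L (a + b) +_) (Θ-Lex⁻¹-empty n m)) (+-identityʳ _))
             (cong₂ _+_ (trans (∣-∣-comm (k (a + b)) (k a)) (m≤n⇒∣m-n∣≡n∸m (q-mono-≤ n m (m≤m+n a b))))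
                        (cong (λ z → ∣ z - k b ∣) (q-empty n m))) ⟩
      L (a + b) + ((k (a + b) ∸ k a) + k b)
        ≡⟨ cong (L (a + b) +_) (trans (+-comm _ (k b)) (sym (σ-small n m a b a+b<N))) ⟩
      L (a + b) + σ n m a b
        ≤⟨ proj₁ (hyp a b (<⇒≤ a<N) b≤a 0<b) (<⇒≤ a+b<N) ⟩
      L a + L b ∎
  }
  where
  open ≤-Reasoning
  L = λ ℓ → Θ (Lex⁻¹ n m ℓ)
  k = q n m
-- The case `a + b = N` belongs here, with `c = 0`, in accordance with the case distinction of `σ`.
... | no a+b≮N = record
  { a′ = N ; b′ = c ; total = m+[n∸m]≡n N≤a+b ; a′≤N = ≤-refl ; b′≤N = ≤-trans c≤b (≤-trans b≤a (<⇒≤ a<N))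
  ; extreme = inj₁ (inj₂ refl)
  ; cost = begin
      L N + L c + (∣ k N - k a ∣ + ∣ k c - k b ∣)
        ≡⟨ cong₂ _+_ (cong (_+ L c) (Θ-Lex⁻¹-full n m))
             (cong₂ _+_ (trans (cong (λ z → ∣ z - k a ∣) (q-full n m)) (trans (∣-∣-comm m (k a)) (m≤n⇒∣m-n∣≡n∸m (q≤m n m a))))
                        (m≤n⇒∣m-n∣≡n∸m (q-mono-≤ n m c≤b))) ⟩
      L c + ((m ∸ k a) + (k b ∸ k c))
        ≡⟨ cong (L c +_) (trans (+-comm (m ∸ k a) _) (sym (σ-large n m a b a+b≮N))) ⟩
      L c + σ n m a b
        ≤⟨ proj₂ (hyp a b (<⇒≤ a<N) b≤a 0<b) N≤a+b ⟩
      L a + L b ∎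
  }
  where
  open ≤-Reasoning
  L = λ ℓ → Θ (Lex⁻¹ n m ℓ)
  k = q n m
  N = m ^ n
  c = a + b ∸ N
  N≤a+b = ≮⇒≥ a+b≮N
  c≤b : c ≤ b
  c≤b = ≤-trans (∸-monoˡ-≤ N (+-monoˡ-≤ b (<⇒≤ a<N))) (≤-reflexive (m+n∸m≡n N b))

-- Only copy `a` may stay partially filled. The movement of `k` is measured in each copy from the
-- original size, not from intermediate ones.
record Concentrated (N : ℕ) (L k : ℕ → ℕ) {m : ℕ} (ℓ : Fin m → ℕ) : Set where
  field
    ℓ′      : Fin m → ℕ
    a       : Fin m
    total   : sum ℓ′ ≡ sum ℓ
    ℓ′≤N    : ∀ x → ℓ′ x ≤ N
    extreme : ∀ x → x ≢ a → Extreme N (ℓ′ x)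
    cost    : ∑[ x < m ] L (ℓ′ x) + ∑[ x < m ] ∣ k (ℓ′ x) - k (ℓ x) ∣ ≤ ∑[ x < m ] L (ℓ x)

update : ∀ {m} → (Fin m → ℕ) → Fin m → ℕ → Fin m → ℕ
update t a c x = if does (x ≟ a) then c else t x

-- The old and the new value stand on opposite sides to avoid subtraction. The summand `g` may
-- depend on the position, so that it can be a distance to the original size there.
sum-update : ∀ {m} (g : Fin m → ℕ → ℕ) (t : Fin m → ℕ) a c →
  ∑[ x < m ] g x (update t a c x) + g a (t a) ≡ ∑[ x < m ] g x (t x) + g a c
sum-update {m} g t a c = begin
  ∑[ x < m ] g x (update t a c x) + g a (t a)
    ≡⟨ cong (∑[ x < m ] g x (update t a c x) +_) (sum-at a (λ x → g x (t x))) ⟨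
  ∑[ x < m ] g x (update t a c x) + ∑[ x < m ] at a x (g x (t x))
    ≡⟨ ∑-distrib-+ (λ x → g x (update t a c x)) (λ x → at a x (g x (t x))) ⟨
  ∑[ x < m ] (g x (update t a c x) + at a x (g x (t x)))
    ≡⟨ sum-cong-≗ pointwise ⟩
  ∑[ x < m ] (g x (t x) + at a x (g x c))
    ≡⟨ ∑-distrib-+ (λ x → g x (t x)) (λ x → at a x (g x c)) ⟩
  ∑[ x < m ] g x (t x) + ∑[ x < m ] at a x (g x c)
    ≡⟨ cong (∑[ x < m ] g x (t x) +_) (sum-at a (λ x → g x c)) ⟩
  ∑[ x < m ] g x (t x) + g a c ∎
  where
  open ≡-Reasoning
  pointwise : ∀ x → g x (update t a c x) + at a x (g x (t x)) ≡ g x (t x) + at a x (g x c)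
  pointwise x with does (x ≟ a)
  ... | true  = +-comm (g x c) (g x (t x))
  ... | false = refl

-- Induction on the number of copies: concentrate the tail, then merge the head with the tail's
-- pivot `c`. One of the two becomes empty or full, and the other is the new pivot.
concentrate : ∀ {N L k m} → Mergeable N L k → (ℓ : Fin (suc m) → ℕ) → (∀ x → ℓ x ≤ N) → Concentrated N L k ℓ
concentrate {N} {L} {k} {zero} mergeable ℓ ℓ≤N = record
  { ℓ′ = ℓ ; a = zero ; total = refl ; ℓ′≤N = ℓ≤N
  ; extreme = λ { zero 0≢0 → contradiction refl 0≢0 }
  ; cost = ≤-reflexive (trans (cong (L (ℓ zero) + 0 +_) (trans (+-identityʳ _) (∣n-n∣≡0 (k (ℓ zero))))) (+-identityʳ _))
  }
concentrate {N} {L} {k} {suc m} mergeable ℓ ℓ≤N = record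
  { ℓ′ = a′ Functional.∷ t″
  ; a = proj₁ pivot
  ; total = +-cancelʳ-≡ r _ _ (begin-equality
      a′ + sum t″ + r          ≡⟨ +-assoc a′ (sum t″) r ⟩
      a′ + (sum t″ + r)        ≡⟨ cong (a′ +_) (sum-update (λ _ x → x) t′ c b′) ⟩
      a′ + (sum t′ + b′)       ≡⟨ rearrange a′ (sum t′) b′ ⟩
      a′ + b′ + sum t′         ≡⟨ cong₂ _+_ M.total C.total ⟩
      h + r + sum t            ≡⟨ rearrange′ h r (sum t) ⟩
      h + sum t + r            ∎)
  ; ℓ′≤N = λ { zero → M.a′≤N ; (suc x) → t″≤N x }
  ; extreme = proj₂ pivot
  ; cost = +-cancelʳ-≤ (L r) _ _ (begin
      L a′ + ∑[ x < suc m ] L (t″ x) + (∣ k a′ - k h ∣ + ∑[ x < suc m ] ∣ k (t″ x) - k (t x) ∣) + L r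
        ≤⟨ +-monoˡ-≤ (L r) (+-monoʳ-≤ (L a′ + ∑[ x < suc m ] L (t″ x)) (+-monoʳ-≤ ∣ k a′ - k h ∣ distance)) ⟩
      L a′ + ∑[ x < suc m ] L (t″ x) + (∣ k a′ - k h ∣ + (D + ∣ k b′ - k r ∣)) + L r
        ≡⟨ collect (L a′) (∑[ x < suc m ] L (t″ x)) ∣ k a′ - k h ∣ D ∣ k b′ - k r ∣ (L r) ⟩
      L a′ + (∣ k a′ - k h ∣ + ∣ k b′ - k r ∣) + (∑[ x < suc m ] L (t″ x) + L r) + D
        ≡⟨ cong (λ z → L a′ + (∣ k a′ - k h ∣ + ∣ k b′ - k r ∣) + z + D) (sum-update (λ _ → L) t′ c b′) ⟩
      L a′ + (∣ k a′ - k h ∣ + ∣ k b′ - k r ∣) + (∑[ x < suc m ] L (t′ x) + L b′) + D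
        ≡⟨ collect′ (L a′) (∣ k a′ - k h ∣ + ∣ k b′ - k r ∣) (∑[ x < suc m ] L (t′ x)) (L b′) D ⟩
      L a′ + L b′ + (∣ k a′ - k h ∣ + ∣ k b′ - k r ∣) + (∑[ x < suc m ] L (t′ x) + D)
        ≤⟨ +-mono-≤ M.cost C.cost ⟩
      L h + L r + ∑[ x < suc m ] L (t x)
        ≡⟨ rearrange′ (L h) (L r) (∑[ x < suc m ] L (t x)) ⟩
      L h + ∑[ x < suc m ] L (t x) + L r ∎)
  }
  where
  open ≤-Reasoning
  h = ℓ zero
  t = ℓ ∘ suc
  tail = concentrate mergeable t (ℓ≤N ∘ suc)
  module C = Concentrated tail
  t′ = C.ℓ′
  c = C.a
  r = t′ c
  merged = merge mergeable h r (ℓ≤N zero) (C.ℓ′≤N c)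
  module M = Merged merged
  a′ = M.a′
  b′ = M.b′
  t″ = update t′ c b′
  D = ∑[ x < suc m ] ∣ k (t′ x) - k (t x) ∣

  rearrange : ∀ a s b → a + (s + b) ≡ a + b + s
  rearrange = solve-∀
  rearrange′ : ∀ h r s → h + r + s ≡ h + s + r
  rearrange′ = solve-∀
  collect : ∀ a s d e f r → a + s + (d + (e + f)) + r ≡ a + (d + f) + (s + r) + e
  collect = solve-∀
  collect′ : ∀ a d s b e → a + d + (s + b) + e ≡ a + b + d + (s + e)
  collect′ = solve-∀

  t″≤N : ∀ x → t″ x ≤ N
  t″≤N x with does (x ≟ c)
  ... | true  = M.b′≤N
  ... | false = C.ℓ′≤N x

  -- Copy `c` moves twice, from `t c` to `r` and on to `b′`. The first move is already charged in
  -- `D`; the triangle inequality adds the second.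
  distance : ∑[ x < suc m ] ∣ k (t″ x) - k (t x) ∣ ≤ D + ∣ k b′ - k r ∣
  distance = +-cancelʳ-≤ ∣ k r - k (t c) ∣ _ _ (begin
    ∑[ x < suc m ] ∣ k (t″ x) - k (t x) ∣ + ∣ k r - k (t c) ∣   ≡⟨ sum-update (λ x y → ∣ k y - k (t x) ∣) t′ c b′ ⟩
    D + ∣ k b′ - k (t c) ∣                                      ≤⟨ +-monoʳ-≤ D (∣-∣-triangle (k b′) (k r) (k (t c))) ⟩
    D + (∣ k b′ - k r ∣ + ∣ k r - k (t c) ∣)                    ≡⟨ +-assoc D _ _ ⟨
    D + ∣ k b′ - k r ∣ + ∣ k r - k (t c) ∣                      ∎)

  pivot : ∃ λ a → ∀ x → x ≢ a → Extreme N ((a′ Functional.∷ t″) x)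
  pivot with M.extreme
  ... | inj₁ ext = suc c , others
    where
    others : ∀ x → x ≢ suc c → Extreme N ((a′ Functional.∷ t″) x)
    others zero    _      = ext
    others (suc x) x≢c with x ≟ c
    ... | yes refl = contradiction refl x≢c
    ... | no  x≢c′ = C.extreme x x≢c′
  ... | inj₂ ext = zero , others
    where
    others : ∀ x → x ≢ zero → Extreme N ((a′ Functional.∷ t″) x)
    others zero    0≢0 = contradiction refl 0≢0
    others (suc x) _ with x ≟ c
    ... | yes _   = ext
    ... | no  x≢c = C.extreme x x≢c

-- The isoperimetric inequality with its corner term

CornerBound : ℕ → ℕ → Set
CornerBound n m = (S : VSet n m) →
  Θ (Lex⁻¹ n m (card S)) + ∣ size (λ i → S (corner n i)) - q n m (card S) ∣ ≤ Θ S

-- With one vertex and no edge, every set is a segment. All corners are the empty word, counted `m`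
-- times both in `size` and in `q`.
cornerBound-zero : ∀ m → CornerBound 0 m
cornerBound-zero m S = ≤-reflexive (begin
  Θ (Lex⁻¹ 0 m (card S)) + ∣ size {m} (λ _ → S []) - q 0 m (card S) ∣
    ≡⟨ cong₂ _+_ (trans (Θ-cong Lex≗S) Θ≡0) (m≡n⇒∣m-n∣≡0 (sym (trans (q≡size 0 m (card S)) (sum-cong-≗ {m} λ _ → cong ⟦_⟧ (Lex≗S []))))) ⟩
  0
    ≡⟨ Θ≡0 ⟨
  Θ S ∎)
  where
  open ≡-Reasoning
  Lex≗S : ∀ v → Lex⁻¹ 0 m (card S) v ≡ S v
  Lex≗S [] with S []
  ... | true  = refl
  ... | false = refl
  Θ≡0 : Θ S ≡ 0
  Θ≡0 = trans (Θ-cong {S = S} {S′ = λ _ → S []} λ { [] → refl }) (Θ-const {0} {m} (S []))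

∣⟦⟧-⟦⟧∣ : ∀ b c → ∣ ⟦ b ⟧ - ⟦ c ⟧ ∣ ≡ ⟦ b xor c ⟧
∣⟦⟧-⟦⟧∣ true  true  = refl
∣⟦⟧-⟦⟧∣ true  false = refl
∣⟦⟧-⟦⟧∣ false true  = refl
∣⟦⟧-⟦⟧∣ false false = refl

-- The entries that disagree with the constant `b` all err in the same direction, so they are
-- counted by the difference in size. Hence making a row constant costs no more than a corner
-- discrepancy.
xor-const : ∀ {m} b (A : Fin m → Bool) → ∑[ y < m ] ⟦ A y xor b ⟧ ≤ ∣ size A - m * ⟦ b ⟧ ∣
xor-const {m} true  A = begin
  ∑[ y < m ] ⟦ A y xor true ⟧   ≡⟨ sum-cong-≗ (λ y → cong ⟦_⟧ (xor-comm (A y) true)) ⟩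
  ∑[ y < m ] ⟦ not (A y) ⟧      ≡⟨ size-not A ⟩
  m ∸ size A                    ≤⟨ m∸n≤∣m-n∣ m (size A) ⟩
  ∣ m - size A ∣                ≡⟨ ∣-∣-comm m (size A) ⟩
  ∣ size A - m ∣                ≡⟨ cong (λ z → ∣ size A - z ∣) (*-identityʳ m) ⟨
  ∣ size A - m * 1 ∣            ∎
  where open ≤-Reasoning
xor-const {m} false A = begin
  ∑[ y < m ] ⟦ A y xor false ⟧  ≡⟨ sum-cong-≗ (λ y → cong ⟦_⟧ (xor-comm (A y) false)) ⟩
  size A                        ≡⟨ ∣-∣-identityʳ (size A) ⟨
  ∣ size A - 0 ∣                ≡⟨ cong (λ z → ∣ size A - z ∣) (*-zeroʳ m) ⟨
  ∣ size A - m * 0 ∣            ∎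
  where open ≤-Reasoning

-- The chain compares the original matrix `M` with `R`, but uses the sizes `ℓ′` after concentration;
-- `R` need not come from a set with these sizes. Both sides carry `p` because both estimates of
-- `cross` contain it.
cornerBound-suc : ∀ n m → Mergeable (m ^ n) (λ ℓ → Θ (Lex⁻¹ n m ℓ)) (q n m) →
  CornerBound n m → CornerBound (suc n) m
cornerBound-suc n zero mergeable bound S = ≤-trans (≤-reflexive (+-identityʳ _)) z≤n
cornerBound-suc n m@(suc _) mergeable bound S = +-cancelʳ-≤ p _ _ (begin
  Θ (Lex⁻¹ (suc n) m (card S)) + ∣ tr - q (suc n) m (card S) ∣ + p
    ≡⟨ cong (λ ℓ → Θ (Lex⁻¹ (suc n) m ℓ) + ∣ tr - q (suc n) m ℓ ∣ + p) card-S ⟩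
  L₁ + ∣ tr - q₁ ∣ + p
    -- `p + δ` is the trace of `R`; it differs from the trace of `M` by at most the number `X` of
    -- diagonal flips.
    ≤⟨ +-monoˡ-≤ p (+-monoʳ-≤ L₁ (∣-∣-triangle tr (p + δ) q₁)) ⟩
  L₁ + (∣ tr - p + δ ∣ + ∣ p + δ - q₁ ∣) + p
    ≡⟨ step₁ L₁ ∣ tr - p + δ ∣ ∣ p + δ - q₁ ∣ p ⟩
  L₁ + p + ∣ p + δ - q₁ ∣ + ∣ tr - p + δ ∣
    ≤⟨ +-mono-≤ lexStep diagonal ⟩
  L r + (p * (m ∸ p) + ∣ p + δ - k r ∣) + X
    ≤⟨ +-monoˡ-≤ X (+-monoʳ-≤ (L r) (cross-rows-lower a A f fa≡false (k r))) ⟩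
  L r + (cross R + p + E) + X
    ≡⟨ step₂ (L r) (cross R) p E X ⟩
  L r + (cross R + X) + E + p
    -- The diagonal flips `X` are absorbed here.
    ≤⟨ +-monoˡ-≤ p (+-monoˡ-≤ E (+-monoʳ-≤ (L r) (cross-lipschitz M R))) ⟩
  L r + (cross M + ∑[ x < m ] ∑[ y < m ] ⟦ M x y xor R x y ⟧) + E + p
    ≡⟨ step₃ (L r) (cross M) (∑[ x < m ] ∑[ y < m ] ⟦ M x y xor R x y ⟧) E p ⟩
  L r + (∑[ x < m ] ∑[ y < m ] ⟦ M x y xor R x y ⟧ + E) + cross M + p
    ≤⟨ +-monoˡ-≤ p (+-monoˡ-≤ (cross M) (+-mono-≤ pivotTerm rowTerms)) ⟩
  ∑[ x < m ] L (ℓ′ x) + ∑[ x < m ] ∣ size (M x) - k (ℓ′ x) ∣ + cross M + p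
    ≤⟨ +-monoˡ-≤ p (+-monoˡ-≤ (cross M) (+-monoʳ-≤ (∑[ x < m ] L (ℓ′ x)) triangle)) ⟩
  ∑[ x < m ] L (ℓ′ x) + (∑[ x < m ] ∣ k (ℓ′ x) - k (ℓ x) ∣ + ∑[ x < m ] ∣ size (M x) - k (ℓ x) ∣) + cross M + p
    ≡⟨ cong (λ z → z + cross M + p) (+-assoc (∑[ x < m ] L (ℓ′ x)) _ _) ⟨
  ∑[ x < m ] L (ℓ′ x) + ∑[ x < m ] ∣ k (ℓ′ x) - k (ℓ x) ∣ + ∑[ x < m ] ∣ size (M x) - k (ℓ x) ∣ + cross M + p
    -- Undoing the concentration: the boundary it saved pays for moving the corner numbers back to
    -- those of the original sizes.
    ≤⟨ +-monoˡ-≤ p (+-monoˡ-≤ (cross M) (+-monoˡ-≤ (∑[ x < m ] ∣ size (M x) - k (ℓ x) ∣) C.cost)) ⟩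
  ∑[ x < m ] L (ℓ x) + ∑[ x < m ] ∣ size (M x) - k (ℓ x) ∣ + cross M + p
    ≡⟨ cong (λ z → z + cross M + p) (∑-distrib-+ (λ x → L (ℓ x)) (λ x → ∣ size (M x) - k (ℓ x) ∣)) ⟨
  ∑[ x < m ] (L (ℓ x) + ∣ size (M x) - k (ℓ x) ∣) + cross M + p
    ≤⟨ +-monoˡ-≤ p (+-monoˡ-≤ (cross M) (sum-mono-≤ λ x → bound (copy S x))) ⟩
  ∑[ x < m ] Θ (copy S x) + cross M + p
    ≡⟨ cong (_+ p) (Θ-suc S) ⟨
  Θ S + p ∎)
  where
  open ≤-Reasoning
  N = m ^ n
  L = λ ℓ → Θ (Lex⁻¹ n m ℓ)
  k = q n m
  M = cornerMatrix S
  ℓ = λ x → card (copy S x)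
  concentrated = concentrate mergeable ℓ (λ x → card≤ (copy S x))
  module C = Concentrated concentrated
  ℓ′ = C.ℓ′
  a = C.a
  r = ℓ′ a
  -- The pivot is excluded even if its new size is `N`; in that case `r = N`, and `p` still stays
  -- below `m`.
  f : Fin m → Bool
  f x = not (does (x ≟ a)) ∧ does (ℓ′ x ℕ≟ N)
  A = M a
  R = rows a A f
  p = size f
  δ = ⟦ A a ⟧
  tr = size (λ x → M x x)
  X = ∑[ x < m ] ⟦ M x x xor R x x ⟧
  E = ∣ size A - k r ∣
  L₁ = Θ (Lex⁻¹ (suc n) m (p * N + r))
  q₁ = q (suc n) m (p * N + r)

  step₁ : ∀ l d e p → l + (d + e) + p ≡ l + p + e + d
  step₁ = solve-∀
  step₂ : ∀ l c p e x → l + (c + p + e) + x ≡ l + (c + x) + e + p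
  step₂ = solve-∀
  step₃ : ∀ l c s e p → l + (c + s) + e + p ≡ l + (s + e) + c + p
  step₃ = solve-∀

  fa≡false : f a ≡ false
  fa≡false = cong (λ b → not b ∧ does (ℓ′ a ℕ≟ N)) (dec-true (a ≟ a) refl)

  row : ∀ {x} → x ≢ a → (ℓ′ x ≡ N × does (ℓ′ x ℕ≟ N) ≡ true) ⊎ (ℓ′ x ≡ 0 × does (ℓ′ x ℕ≟ N) ≡ false)
  row {x} x≢a with ℓ′ x ℕ≟ N | C.extreme x x≢a
  ... | yes full  | _          = inj₁ (full , dec-true (ℓ′ x ℕ≟ N) full)
  ... | no  ¬full | inj₁ empty = inj₂ (empty , dec-false (ℓ′ x ℕ≟ N) ¬full)
  ... | no  ¬full | inj₂ full  = contradiction full ¬full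

  card-S : card S ≡ p * N + r
  card-S = begin-equality
    card S                                                    ≡⟨ card-suc S ⟩
    sum ℓ                                                     ≡⟨ C.total ⟨
    sum ℓ′                                                    ≡⟨ sum-cong-≗ pointwise ⟩
    ∑[ x < m ] (⟦ f x ⟧ * N + at a x (ℓ′ x))                  ≡⟨ ∑-distrib-+ (λ x → ⟦ f x ⟧ * N) (λ x → at a x (ℓ′ x)) ⟩
    ∑[ x < m ] (⟦ f x ⟧ * N) + ∑[ x < m ] at a x (ℓ′ x)       ≡⟨ cong₂ _+_ (sym (*-distribʳ-sum N (λ x → ⟦ f x ⟧))) (sum-at a ℓ′) ⟩
    p * N + r                                                 ∎
    where
    pointwise : ∀ x → ℓ′ x ≡ ⟦ f x ⟧ * N + at a x (ℓ′ x)
    pointwise x with x ≟ a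
    ... | yes _ = refl
    ... | no x≢a with row x≢a
    ...   | inj₁ (full  , b≡) = trans full (sym (trans (cong (λ b → ⟦ b ⟧ * N + 0) b≡) (trans (+-identityʳ (N + 0)) (+-identityʳ N))))
    ...   | inj₂ (empty , b≡) = trans empty (sym (cong (λ b → ⟦ b ⟧ * N + 0) b≡))

  p<m : p < m
  p<m = begin
    suc p                                       ≡⟨ +-comm 1 p ⟩
    p + 1                                       ≡⟨ cong (p +_) (sum-at a (λ _ → 1)) ⟨
    p + ∑[ x < m ] at a x 1                     ≡⟨ ∑-distrib-+ (λ x → ⟦ f x ⟧) (λ x → at a x 1) ⟨
    ∑[ x < m ] (⟦ f x ⟧ + at a x 1)             ≤⟨ sum-mono-≤ pointwise ⟩
    ∑[ _ < m ] 1                                ≡⟨ trans (sum-const m 1) (*-identityʳ m) ⟩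
    m                                           ∎
    where
    pointwise : ∀ x → ⟦ f x ⟧ + at a x 1 ≤ 1
    pointwise x with does (x ≟ a)
    ... | true  = ≤-refl
    ... | false = ≤-trans (≤-reflexive (+-identityʳ _)) (⟦⟧≤1 (does (ℓ′ x ℕ≟ N)))

  -- Only the number of full copies matters: the segment of the same size has its pivot at index
  -- `p`, wherever `a` may be.
  lexStep : L₁ + p + ∣ p + δ - q₁ ∣ ≤ L r + (p * (m ∸ p) + ∣ p + δ - k r ∣)
  lexStep = subst
    (λ p → Θ (Lex⁻¹ (suc n) m (p * N + r)) + p + ∣ p + δ - q (suc n) m (p * N + r) ∣ ≤
           L r + (p * (m ∸ p) + ∣ p + δ - k r ∣))
    (toℕ-fromℕ< p<m) (Θ-Lex⁻¹-suc-≤ n (fromℕ< p<m) (C.ℓ′≤N a) (A a))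

  diagonal : ∣ tr - p + δ ∣ ≤ X
  diagonal = begin
    ∣ tr - p + δ ∣                                   ≡⟨ cong (λ z → ∣ tr - z ∣) (trace-rows a A f fa≡false) ⟨
    ∣ tr - size (λ x → R x x) ∣                      ≤⟨ ∣sum-sum∣≤ (λ x → ⟦ M x x ⟧) (λ x → ⟦ R x x ⟧) ⟩
    ∑[ x < m ] ∣ ⟦ M x x ⟧ - ⟦ R x x ⟧ ∣             ≡⟨ sum-cong-≗ (λ x → ∣⟦⟧-⟦⟧∣ (M x x) (R x x)) ⟩
    X                                                ∎

  pivotTerm : L r ≤ ∑[ x < m ] L (ℓ′ x)
  pivotTerm = begin
    L r                              ≡⟨ sum-at a (λ x → L (ℓ′ x)) ⟨
    ∑[ x < m ] at a x (L (ℓ′ x))     ≤⟨ sum-mono-≤ pointwise ⟩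
    ∑[ x < m ] L (ℓ′ x)              ∎
    where
    pointwise : ∀ x → at a x (L (ℓ′ x)) ≤ L (ℓ′ x)
    pointwise x with does (x ≟ a)
    ... | true  = ≤-refl
    ... | false = z≤n

  -- The pivot row has no flips and contributes `E`. For a full or empty copy `k (ℓ′ x)` is `m` or
  -- `0`, so `xor-const` bounds its flips by its corner discrepancy.
  rowTerms : ∑[ x < m ] ∑[ y < m ] ⟦ M x y xor R x y ⟧ + E ≤ ∑[ x < m ] ∣ size (M x) - k (ℓ′ x) ∣
  rowTerms = begin
    ∑[ x < m ] ∑[ y < m ] ⟦ M x y xor R x y ⟧ + E
      ≡⟨ cong (∑[ x < m ] ∑[ y < m ] ⟦ M x y xor R x y ⟧ +_) (sum-at a (λ x → ∣ size (M x) - k (ℓ′ x) ∣)) ⟨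
    ∑[ x < m ] ∑[ y < m ] ⟦ M x y xor R x y ⟧ + ∑[ x < m ] at a x ∣ size (M x) - k (ℓ′ x) ∣
      ≡⟨ ∑-distrib-+ (λ x → ∑[ y < m ] ⟦ M x y xor R x y ⟧) (λ x → at a x ∣ size (M x) - k (ℓ′ x) ∣) ⟨
    ∑[ x < m ] (∑[ y < m ] ⟦ M x y xor R x y ⟧ + at a x ∣ size (M x) - k (ℓ′ x) ∣)
      ≤⟨ sum-mono-≤ pointwise ⟩
    ∑[ x < m ] ∣ size (M x) - k (ℓ′ x) ∣ ∎
    where
    pointwise : ∀ x → ∑[ y < m ] ⟦ M x y xor R x y ⟧ + at a x ∣ size (M x) - k (ℓ′ x) ∣ ≤ ∣ size (M x) - k (ℓ′ x) ∣
    pointwise x with x ≟ a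
    ... | yes refl = +-monoˡ-≤ _ (≤-reflexive (sum-zero λ y → cong ⟦_⟧ (xor-same (M a y))))
    ... | no x≢a = ≤-trans (≤-reflexive (+-identityʳ _)) constantRow
      where
      constantRow : ∑[ y < m ] ⟦ M x y xor does (ℓ′ x ℕ≟ N) ⟧ ≤ ∣ size (M x) - k (ℓ′ x) ∣
      constantRow with row x≢a
      ... | inj₁ (full  , b≡) = ≤-trans (≤-reflexive (cong (λ b → ∑[ y < m ] ⟦ M x y xor b ⟧) b≡)) (≤-trans (xor-const true (M x))
              (≤-reflexive (cong (λ z → ∣ size (M x) - z ∣) (trans (*-identityʳ m) (sym (trans (cong k full) (q-full n m)))))))
      ... | inj₂ (empty , b≡) = ≤-trans (≤-reflexive (cong (λ b → ∑[ y < m ] ⟦ M x y xor b ⟧) b≡)) (≤-trans (xor-const false (M x))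
              (≤-reflexive (cong (λ z → ∣ size (M x) - z ∣) (trans (*-zeroʳ m) (sym (trans (cong k empty) (q-empty n m)))))))

  triangle : ∑[ x < m ] ∣ size (M x) - k (ℓ′ x) ∣ ≤ ∑[ x < m ] ∣ k (ℓ′ x) - k (ℓ x) ∣ + ∑[ x < m ] ∣ size (M x) - k (ℓ x) ∣
  triangle = begin
    ∑[ x < m ] ∣ size (M x) - k (ℓ′ x) ∣
      ≤⟨ sum-mono-≤ (λ x → ≤-trans (∣-∣-triangle (size (M x)) (k (ℓ x)) (k (ℓ′ x)))
           (≤-reflexive (trans (+-comm ∣ size (M x) - k (ℓ x) ∣ _) (cong (_+ ∣ size (M x) - k (ℓ x) ∣) (∣-∣-comm (k (ℓ x)) (k (ℓ′ x))))))) ⟩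
    ∑[ x < m ] (∣ k (ℓ′ x) - k (ℓ x) ∣ + ∣ size (M x) - k (ℓ x) ∣)
      ≡⟨ ∑-distrib-+ (λ x → ∣ k (ℓ′ x) - k (ℓ x) ∣) (λ x → ∣ size (M x) - k (ℓ x) ∣) ⟩
    ∑[ x < m ] ∣ k (ℓ′ x) - k (ℓ x) ∣ + ∑[ x < m ] ∣ size (M x) - k (ℓ x) ∣ ∎

cornerBound : ∀ m → (∀ n → 1 ≤ n → SubadditiveΘ n m) → ∀ n → CornerBound n m
cornerBound m hyp zero          = cornerBound-zero m
-- The copies are single vertices, so `N = 1` and no size lies strictly between 0 and `N`: there is
-- nothing to merge.
cornerBound m hyp (suc zero)    = cornerBound-suc 0 m (λ { a b b≤a 0<b (s≤s a≤0) → contradiction (≤-trans 0<b (≤-trans b≤a a≤0)) λ () }) (cornerBound m hyp 0)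
cornerBound m hyp (suc (suc n)) = cornerBound-suc (suc n) m (Θ-mergeable (suc n) m (hyp (suc n) (s≤s z≤n))) (cornerBound m hyp (suc n))

-- Exterior edges

exterior : Bool → Bool → Bool → ℕ
exterior i κ b = ⟦ (i ∨ κ) ∧ (i xor b) ⟧

exteriorΘ≡sum : ∀ {n m} s t (S : VSet n m) →
  exteriorΘ s t S ≡ ∑[ i < m ] exterior (inI s i) (inK s t i) (S (corner n i))
exteriorΘ≡sum {n} {m} s t S = count-allFin (λ (i : Fin m) → T? ((inI s i ∨ inK s t i) ∧ (inI s i xor S (corner n i))))

-- Any set `A` of corners gives at least |I| - |A| and at least |A| - |I| - |J| exterior edges. The
-- first `k` corners attain the largest of 0 and these bounds at |A| = k, and the bounds change by
-- at most one per corner.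
exteriorΘ-initial : ∀ {m} s t {k} → k ≤ m → (A : Fin m → Bool) →
  ∑[ i < m ] exterior (inI s i) (inK s t i) (initial k i) ≤
  ∣ size A - k ∣ + ∑[ i < m ] exterior (inI s i) (inK s t i) (A i)
exteriorΘ-initial {m} s t {k} k≤m A with k ≤? s | s + t ≤? k
-- The segment lies in I, and the rest of I is counted.
... | yes k≤s | _ = +-cancelʳ-≤ k _ _ (begin
  ext (initial k) + k                    ≡⟨ cong (ext (initial k) +_) (size-initial k≤m) ⟨
  ext (initial k) + size (initial {m} k) ≡⟨ ∑-distrib-+ {m} (λ i → exterior (inI s i) (inK s t i) (initial k i)) (λ i → ⟦ initial k i ⟧) ⟨
  ∑[ i < m ] (exterior (inI s i) (inK s t i) (initial k i) + ⟦ initial k i ⟧)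
                                         ≤⟨ sum-mono-≤ (λ i → upper (inI s i) (inK s t i) (initial k i) (inside i)) ⟩
  size {m} (inI s)                       ≤⟨ sum-mono-≤ (λ i → lower (inI s i) (inK s t i) (A i)) ⟩
  ∑[ i < m ] (⟦ A i ⟧ + exterior (inI s i) (inK s t i) (A i))
                                         ≡⟨ ∑-distrib-+ (λ i → ⟦ A i ⟧) (λ i → exterior (inI s i) (inK s t i) (A i)) ⟩
  size A + ext A                         ≤⟨ +-monoˡ-≤ (ext A) (m≤∣m-n∣+n (size A) k) ⟩
  ∣ size A - k ∣ + k + ext A             ≡⟨ rearrange ∣ size A - k ∣ k (ext A) ⟩
  ∣ size A - k ∣ + ext A + k             ∎)
  where
  open ≤-Reasoning
  ext : (Fin m → Bool) → ℕ
  ext B = ∑[ i < m ] exterior (inI s i) (inK s t i) (B i)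
  rearrange : ∀ d k e → d + k + e ≡ d + e + k
  rearrange = solve-∀
  inside : ∀ (i : Fin m) → initial k i ≡ true → inI s i ≡ true
  inside i i<k = dec-true (toℕ i <? s) (≤-trans (does-true (toℕ i <? k) i<k) k≤s)
  upper : ∀ i κ b → (b ≡ true → i ≡ true) → exterior i κ b + ⟦ b ⟧ ≤ ⟦ i ⟧
  upper true  κ     true  _   = ≤-refl
  upper true  κ     false _   = ≤-refl
  upper false κ     true  b⇒i = contradiction (b⇒i refl) λ ()
  upper false true  false _   = ≤-refl
  upper false false false _   = ≤-refl
  lower : ∀ i κ b → ⟦ i ⟧ ≤ ⟦ b ⟧ + exterior i κ b
  lower true  κ true  = ≤-refl
  lower true  κ false = ≤-refl
  lower false κ b     = z≤n
-- The segment contains I and J, whose joint size is `inner`; its part in K is counted.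
... | no _ | yes s+t≤k = +-cancelʳ-≤ inner _ _ (begin
  ext (initial k) + inner                ≡⟨ ∑-distrib-+ {m} (λ i → exterior (inI s i) (inK s t i) (initial k i)) (λ i → ⟦ not (inK s t i) ⟧) ⟨
  ∑[ i < m ] (exterior (inI s i) (inK s t i) (initial k i) + ⟦ not (inK s t i) ⟧)
                                         ≤⟨ sum-mono-≤ (λ i → upper (inI s i) (inK s t i) (initial k i) (inside i) (disjoint i)) ⟩
  size (initial {m} k)                   ≡⟨ size-initial k≤m ⟩
  k                                      ≤⟨ m≤∣m-n∣+n k (size A) ⟩
  ∣ k - size A ∣ + size A                ≡⟨ cong (_+ size A) (∣-∣-comm k (size A)) ⟩
  ∣ size A - k ∣ + size A                ≤⟨ +-monoʳ-≤ ∣ size A - k ∣ (sum-mono-≤ (λ i → lower (inI s i) (inK s t i) (A i) (disjoint i))) ⟩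
  ∣ size A - k ∣ + ∑[ i < m ] (exterior (inI s i) (inK s t i) (A i) + ⟦ not (inK s t i) ⟧)
                                         ≡⟨ cong (∣ size A - k ∣ +_) (∑-distrib-+ (λ i → exterior (inI s i) (inK s t i) (A i)) (λ i → ⟦ not (inK s t i) ⟧)) ⟩
  ∣ size A - k ∣ + (ext A + inner)       ≡⟨ +-assoc ∣ size A - k ∣ (ext A) inner ⟨
  ∣ size A - k ∣ + ext A + inner         ∎)
  where
  open ≤-Reasoning
  ext : (Fin m → Bool) → ℕ
  ext B = ∑[ i < m ] exterior (inI s i) (inK s t i) (B i)
  inner = ∑[ i < m ] ⟦ not (inK s t i) ⟧
  inside : ∀ (i : Fin m) → inK s t i ≡ false → initial k i ≡ true
  inside i i∉K = dec-true (toℕ i <? k) (≤-trans (≰⇒> (does-false (s + t ≤? toℕ i) i∉K)) s+t≤k)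
  disjoint : ∀ (i : Fin m) → inI s i ≡ true → inK s t i ≡ false
  disjoint i i∈I = dec-false (s + t ≤? toℕ i) (<⇒≱ (≤-trans (does-true (toℕ i <? s) i∈I) (m≤m+n s t)))
  upper : ∀ i κ b → (κ ≡ false → b ≡ true) → (i ≡ true → κ ≡ false) → exterior i κ b + ⟦ not κ ⟧ ≤ ⟦ b ⟧
  upper true  true  b     _   i⇒κ = contradiction (i⇒κ refl) λ ()
  upper i     false false κ⇒b _   = contradiction (κ⇒b refl) λ ()
  upper true  false true  _   _   = ≤-refl
  upper false false true  _   _   = ≤-refl
  upper false true  true  _   _   = ≤-refl
  upper false true  false _   _   = ≤-refl
  lower : ∀ i κ b → (i ≡ true → κ ≡ false) → ⟦ b ⟧ ≤ exterior i κ b + ⟦ not κ ⟧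
  lower true  true  b     i⇒κ = contradiction (i⇒κ refl) λ ()
  lower false true  true  _   = ≤-refl
  lower i     false true  _   = m≤n+m 1 (exterior i false true)
  lower i     κ     false _   = z≤n
-- The segment contains I and misses K, so no exterior edge is counted.
... | no k≰s | no s+t≰k = ≤-trans (≤-reflexive (sum-zero λ i → vanish (inI s i) (inK s t i) (initial k i) (inside i) (outside i))) z≤n
  where
  inside : ∀ (i : Fin m) → inI s i ≡ true → initial k i ≡ true
  inside i i∈I = dec-true (toℕ i <? k) (≤-trans (does-true (toℕ i <? s) i∈I) (<⇒≤ (≰⇒> k≰s)))
  outside : ∀ (i : Fin m) → inK s t i ≡ true → initial k i ≡ false
  outside i i∈K = dec-false (toℕ i <? k) (≤⇒≯ (≤-trans (<⇒≤ (≰⇒> s+t≰k)) (does-true (s + t ≤? toℕ i) i∈K)))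
  vanish : ∀ i κ b → (i ≡ true → b ≡ true) → (κ ≡ true → b ≡ false) → exterior i κ b ≡ 0
  vanish true  κ     true  _   _   = refl
  vanish true  κ     false i⇒b _   = contradiction (i⇒b refl) λ ()
  vanish false false b     _   _   = refl
  vanish false true  false _   _   = refl
  vanish false true  true  _   κ⇒b = contradiction (κ⇒b refl) λ ()

theorem1 : ((n m ℓa ℓb : ℕ) → 1 ≤ n → 2 ≤ m → ℓa ≤ m ^ n → ℓb ≤ ℓa → 0 < ℓb →
    (ℓa + ℓb ≤ m ^ n →
    Θ (Lex⁻¹ n m (ℓa + ℓb)) + σ n m ℓa ℓb ≤ Θ (Lex⁻¹ n m ℓa) + Θ (Lex⁻¹ n m ℓb)) ×
    (m ^ n ≤ ℓa + ℓb →
    Θ (Lex⁻¹ n m (ℓa + ℓb ∸ m ^ n)) + σ n m ℓa ℓb ≤ Θ (Lex⁻¹ n m ℓa) + Θ (Lex⁻¹ n m ℓb))) →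
    (n m s t ℓ : ℕ) → 1 ≤ n → 2 ≤ m → s + t ≤ m → ℓ ≤ m ^ n →
    (card (Lex⁻¹ n m ℓ) ≡ ℓ) ×
    ((S : VSet n m) → card S ≡ ℓ → Θst s t (Lex⁻¹ n m ℓ) ≤ Θst s t S)
theorem1 hyp n m s t ℓ 1≤n 2≤m s+t≤m ℓ≤ = card-Lex⁻¹ n m ℓ (<⇒≤ 2≤m) ℓ≤ , minimal
  where
  open ≤-Reasoning
  minimal : (S : VSet n m) → card S ≡ ℓ → Θst s t (Lex⁻¹ n m ℓ) ≤ Θst s t S
  minimal S refl = begin
    L + exteriorΘ s t (Lex⁻¹ n m ℓ)
      ≡⟨ cong (L +_) (trans (exteriorΘ≡sum s t (Lex⁻¹ n m ℓ))
           (sum-cong-≗ λ i → cong (exterior (inI s i) (inK s t i)) (Lex⁻¹-corner n m ℓ i))) ⟩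
    L + ∑[ i < m ] exterior (inI s i) (inK s t i) (initial (q n m ℓ) i)
      -- Passing from the corners of the segment to those of `S` costs at most the difference of
      -- their numbers, which is the surplus that `cornerBound` provides below.
      ≤⟨ +-monoʳ-≤ L (exteriorΘ-initial s t (q≤m n m ℓ) (λ i → S (corner n i))) ⟩
    L + (∣ size (λ i → S (corner n i)) - q n m ℓ ∣ + ∑[ i < m ] exterior (inI s i) (inK s t i) (S (corner n i)))
      ≡⟨ trans (sym (+-assoc L _ _)) (cong (L + ∣ size (λ i → S (corner n i)) - q n m ℓ ∣ +_) (sym (exteriorΘ≡sum s t S))) ⟩
    L + ∣ size (λ i → S (corner n i)) - q n m ℓ ∣ + exteriorΘ s t S
      ≤⟨ +-monoˡ-≤ (exteriorΘ s t S) (cornerBound m (λ n 1≤n ℓa ℓb → hyp n m ℓa ℓb 1≤n 2≤m) n S) ⟩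
    Θ S + exteriorΘ s t S ∎
    where L = Θ (Lex⁻¹ n m ℓ)
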